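{- Let $N$ be a network of the session calculus that is guardedly well-typed and race-free. Then $N$ satisfies $\mathcal{L}(\mathrm{J})$.
   Context: Session calculus. Fix sets of locations $p,q,r,\dots$, labels $\lambda,\mu$ and recursion variables $X,Y$. Threads: $P ::= \mathbf{end} \mid \bigoplus_{i\in I} p_i!\lambda_i;P_i \mid \sum_{i\in I} p_i?\lambda_i;P_i \mid X \mid \mu X.P$, with $I$ finite (nonempty for $\bigoplus$) and expressions $\mu X.X$, $\mu X.\mu Y.P$ excluded. Networks: $N ::= p[\![P]\!] \mid 0 \mid N\parallel N$; $p$ is a location of $N$ if $p[\![P]\!]$ occurs in $N$; in a network all locations are distinct, all threads are closed, and every location named in a send $p!\lambda$ or receive $p?\lambda$ is a location of $N$. Thread states additionally allow the form $\langle q!\lambda\rangle;P$ (an output already selected); network states are built from located thread states likewise. Network states are taken modulo the structural congruence $\equiv$ given by associativity and commutativity of $\parallel$ and $N\parallel 0\equiv N$. $\mathrm{proc}(p,N)$ is the unique thread state $P$ with $N\equiv p[\![P]\!]\parallel N'$. The transition relation is the least relation closed under $\equiv$ containing, for all $N$: (choice) $p[\![\bigoplus_{i\in I}p_i!\lambda_i;P_i]\!]\parallel N \xrightarrow{\tau} p[\![\langle p_k!\lambda_k\rangle;P_k]\!]\parallel N$ for $k\in I$; (unfold) $p[\![\mu X.P]\!]\parallel N\xrightarrow{\tau} p[\![P\{\mu X.P/X\}]\!]\parallel N$; (comm) $p_k[\![\langle q!\lambda_k\rangle;Q]\!]\parallel q[\![\sum_{i\in I}p_i?\lambda_i;P_i]\!]\parallel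 N \xrightarrow{(p_k,\lambda_k,q)} p_k[\![Q]\!]\parallel q[\![P_k]\!]\parallel N$ for $k\in I$. For a transition $t$, $\mathrm{comp}(t)$ is the single location moving in a $\tau$-transition, and $\{p,q\}$ for a transition labelled $(p,\lambda,q)$; $t$ involves $p$ if $p\in\mathrm{comp}(t)$; transitions $t,u$ are concurrent if $\mathrm{comp}(t)\cap\mathrm{comp}(u)=\emptyset$. A path is a network state $N_0$ with a maximal (infinite, or ending in a state without outgoing transitions) sequence of transitions $N_i\xrightarrow{\alpha_i}N_{i+1}$. A location $p$ successfully terminates on a path if $\mathrm{proc}(p,N_i)=\mathbf{end}$ for some state $N_i$ on it. Justness: a path $\pi$ is just if for every suffix of $\pi$ starting in a state $s$ and every transition $t$ enabled in $s$, that suffix contains a transition $u$ not concurrent with $t$. For a fairness assumption $F$ (a designated set of "$F$-fair" paths), a network $N$ satisfies $\mathcal{L}(F)$ if for every $F$-fair path $\pi$ starting in $N$ and every location $p$ of $N$, either $p$ successfully terminates on $\pi$ or $\pi$ contains infinitely many transitions involving $p$. $\mathcal{L}(\mathrm{J})$ uses the just paths as fair paths. Races: a network state $N$ has a race if $N\xrightarrow{(p,\lambda,r)}N'$ and $N\xrightarrow{(q,\mu,r)}N''$ with $p\neq q$ or $N'\neq N''$. A network (state) is race-free if no network state reachable from it has a race. Global types: $G ::= \mathbf{end} \mid \boxplus_{i\in I} p\to q_i{:}\lambda_i;G_i \mid X \mid \mu X.G$, $I$ finite nonempty, $p\neq q_i$, $\mu X.X$ and $\mu X.\mu Y.G$ excluded.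 Participants: $\mathrm{pt}(\mathbf{end})=\mathrm{pt}(X)=\emptyset$, $\mathrm{pt}(\mu X.G)=\mathrm{pt}(G)$, $\mathrm{pt}(\boxplus_{i\in I}p\to q_i{:}\lambda_i;G_i)=\bigcup_{i}(\{p,q_i\}\cup\mathrm{pt}(G_i))$. Projection types are like threads but with receives only of the unary form $p?\lambda;Q$, plus a merge $\sqcap_{i\in I}Q_i$. Projection $G\upharpoonright r$: $\mathbf{end}\upharpoonright r=\mathbf{end}$; $X\upharpoonright r=X$; $(\mu X.G)\upharpoonright r=\mathbf{end}$ if $r\notin\mathrm{pt}(G)$ and $\mu X.G$ is closed, else $\mu X.(G\upharpoonright r)$; $(\boxplus_{i\in I}p\to q_i{:}\lambda_i;G_i)\upharpoonright r$ equals $\bigoplus_{i\in I}q_i!\lambda_i;(G_i\upharpoonright r)$ if $r=p$, and otherwise $\sqcap_{i\in I}((p\to q_i{:}\lambda_i;G_i)\upharpoonright r)$, where for a single branch $(p\to q{:}\lambda;G)\upharpoonright r$ is $p?\lambda;(G\upharpoonright r)$ if $r=q$ and $G\upharpoonright r$ if $r\notin\{p,q\}$. The judgement $P\vdash Q$ (thread state vs projection type) is the largest relation closed under the rules: $P\{\mu X.P/X\}\vdash Q \Rightarrow \mu X.P\vdash Q$; $P\vdash Q\{\mu X.Q/X\}\Rightarrow P\vdash \mu X.Q$; $\mathbf{end}\vdash\mathbf{end}$; ($i\in I$, $P_i\vdash Q_i$) $\Rightarrow \sum_{i\in I}p_i?\lambda_i;P_i\vdash p_i?\lambda_i;Q_i$;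 ($I\subseteq J$, $P_i\vdash Q_i$ for all $i\in I$) $\Rightarrow \bigoplus_{i\in I}p_i!\lambda_i;P_i\vdash\bigoplus_{i\in J}p_i!\lambda_i;Q_i$; ($P\vdash Q_i$ for all $i\in I$) $\Rightarrow P\vdash\sqcap_{i\in I}Q_i$; ($k\in I$, $P_k\vdash Q_k$) $\Rightarrow \langle q_k!\lambda_k\rangle;P_k\vdash\bigoplus_{i\in I}q_i!\lambda_i;Q_i$. A projection type is guarded if every occurrence of a variable $X$ inside a subexpression $\mu X.Q$ lies within a subexpression $p!\lambda;Q'$ or $p?\lambda;Q'$. A network (state) $N$ with locations $p_1,\dots,p_n$ satisfies $N\vdash G$ if $G$ is closed, $\mathrm{pt}(G)\subseteq\{p_1,\dots,p_n\}$ and $\mathrm{proc}(p_i,N)\vdash G\upharpoonright p_i$ for all $i$; $N\vdash_g G$ (guardedly well-typed w.r.t. $G$) if moreover every $G\upharpoonright p_i$ is guarded; $N$ is guardedly well-typed if $N\vdash_g G$ for some $G$. -}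

module Defs where

open import Data.Bool using (if_then_else_)
open import Data.Fin using (Fin; zero; suc)
open import Data.Fin.Subset using (Subset; ⊥; ⁅_⁆; _∪_; Empty)
open import Data.Fin.Subset.Properties using (nonempty?)
open import Data.List using (List; []; _∷_; _++_; map)
open import Data.List.Membership.Propositional using (_∈_)
import Data.List.Membership.DecPropositional as DecMembership
open import Data.List.Relation.Binary.Disjoint.Propositional using (Disjoint)
open import Data.List.Relation.Binary.Subset.Propositional using (_⊆_)
open import Data.List.Relation.Unary.Unique.Propositional using (Unique)
open import Data.Nat using (ℕ; zero; suc; _≤_; _<_)
open import Data.Product using (∃; ∃-syntax; _×_; _,_; proj₁)
open import Data.Sum using (_⊎_)
open import Data.Unit using (⊤)
open import Data.Vec using (Vec; []; _∷_; lookup; tail)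
open import Function.Definitions using (Injective)
open import Relation.Binary using (DecidableEquality)
open import Relation.Binary.Construct.Closure.ReflexiveTransitive using (Star)
open import Relation.Binary.PropositionalEquality using (_≡_; _≢_)
open import Relation.Nullary using (¬_; Dec; does; ¬?; _×-dec_)

data Length : Set where
  finite   : ℕ → Length
  infinite : Length

_<ᴸ_ : ℕ → Length → Set
i <ᴸ finite n = i < n
i <ᴸ infinite = ⊤

_≤ᴸ_ : ℕ → Length → Set
i ≤ᴸ finite n = i ≤ n
i ≤ᴸ infinite = ⊤

module Session (Loc Lab : Set) (_≟_ : DecidableEquality Loc) where

  open DecMembership _≟_ using (_∈?_)

  -- A finite family indexed by I is a vector of branches, with I = Fin k;
  -- nonempty families have k = suc k′.  Different branches of a family may
  -- carry the same location and label.
  record Branch (A : Set) : Set where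
    constructor _·_⟫_
    field
      loc   : Loc
      label : Lab
      cont  : A

  open Branch public

  -- Recursion variables are well-scoped de Bruijn indices, so Thread 0 is the
  -- type of closed threads (likewise for Proj and Global).  The excluded
  -- expressions μX.X and μX.μY.P are ruled out by WFᵀ, not by the grammar:
  -- μX.Y with Y ≠ X is not excluded, and unfolding an enclosing μY turns it
  -- into a thread of the form μX.μY.P.
  data Thread (n : ℕ) : Set where
    end : Thread n
    ⊕   : ∀ {k} → Vec (Branch (Thread n)) (suc k) → Thread n
    Σ?  : ∀ {k} → Vec (Branch (Thread n)) k → Thread n
    var : Fin n → Thread n
    μ   : Thread (suc n) → Thread n

  data WFᵀ {n : ℕ} : Thread n → Set where
    end : WFᵀ end
    ⊕   : ∀ {k} {bs : Vec (Branch (Thread n)) (suc k)} →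
          (∀ i → WFᵀ (cont (lookup bs i))) → WFᵀ (⊕ bs)
    Σ?  : ∀ {k} {bs : Vec (Branch (Thread n)) k} →
          (∀ i → WFᵀ (cont (lookup bs i))) → WFᵀ (Σ? bs)
    var : ∀ {x} → WFᵀ (var x)
    μ   : ∀ {P} → P ≢ var zero → (∀ P′ → P ≢ μ P′) → WFᵀ P → WFᵀ (μ P)

  -- The locations named in the sends and receives of a thread.
  names  : ∀ {n} → Thread n → List Loc
  namesᵇ : ∀ {n k} → Vec (Branch (Thread n)) k → List Loc
  names end     = []
  names (⊕ bs)  = namesᵇ bs
  names (Σ? bs) = namesᵇ bs
  names (var x) = []
  names (μ P)   = names P
  namesᵇ []                 = []
  namesᵇ ((p · a ⟫ P) ∷ bs) = p ∷ names P ++ namesᵇ bs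

  liftᵣ : ∀ {m n} → (Fin m → Fin n) → Fin (suc m) → Fin (suc n)
  liftᵣ ρ zero    = zero
  liftᵣ ρ (suc x) = suc (ρ x)

  ren  : ∀ {m n} → (Fin m → Fin n) → Thread m → Thread n
  renᵇ : ∀ {m n k} → (Fin m → Fin n) →
         Vec (Branch (Thread m)) k → Vec (Branch (Thread n)) k
  ren ρ end     = end
  ren ρ (⊕ bs)  = ⊕ (renᵇ ρ bs)
  ren ρ (Σ? bs) = Σ? (renᵇ ρ bs)
  ren ρ (var x) = var (ρ x)
  ren ρ (μ P)   = μ (ren (liftᵣ ρ) P)
  renᵇ ρ []                 = []
  renᵇ ρ ((p · a ⟫ P) ∷ bs) = (p · a ⟫ ren ρ P) ∷ renᵇ ρ bs

  liftₛ : ∀ {m n} → (Fin m → Thread n) → Fin (suc m) → Thread (suc n)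
  liftₛ σ zero    = var zero
  liftₛ σ (suc x) = ren suc (σ x)

  sub  : ∀ {m n} → (Fin m → Thread n) → Thread m → Thread n
  subᵇ : ∀ {m n k} → (Fin m → Thread n) →
         Vec (Branch (Thread m)) k → Vec (Branch (Thread n)) k
  sub σ end     = end
  sub σ (⊕ bs)  = ⊕ (subᵇ σ bs)
  sub σ (Σ? bs) = Σ? (subᵇ σ bs)
  sub σ (var x) = σ x
  sub σ (μ P)   = μ (sub (liftₛ σ) P)
  subᵇ σ []                 = []
  subᵇ σ ((p · a ⟫ P) ∷ bs) = (p · a ⟫ sub σ P) ∷ subᵇ σ bs

  single : ∀ {n} → Thread n → Fin (suc n) → Thread n
  single Q zero    = Q
  single Q (suc x) = var x

  _[_/0] : ∀ {n} → Thread (suc n) → Thread n → Thread n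
  P [ Q /0] = sub (single Q) P

  data ThreadState : Set where
    thread : Thread 0 → ThreadState
    ⟨_!_⟩_ : Loc → Lab → Thread 0 → ThreadState

  infixr 5 _∥_

  data NetState : Set where
    _⟦_⟧ : Loc → ThreadState → NetState
    𝟘    : NetState
    _∥_  : NetState → NetState → NetState

  components : NetState → List (Loc × ThreadState)
  components (p ⟦ S ⟧) = (p , S) ∷ []
  components 𝟘         = []
  components (M ∥ N)   = components M ++ components N

  locs : NetState → List Loc
  locs N = map proj₁ (components N)

  record IsNetwork (N : NetState) : Set where
    field
      distinct : Unique (locs N)
      threads  : ∀ {p S} → (p , S) ∈ components N →
                 ∃[ P ] S ≡ thread P × WFᵀ P × names P ⊆ locs N

  infix 4 _≅_

  data _≅_ : NetState → NetState → Set where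
    refl     : ∀ {N} → N ≅ N
    sym      : ∀ {M N} → M ≅ N → N ≅ M
    trans    : ∀ {L M N} → L ≅ M → M ≅ N → L ≅ N
    cong     : ∀ {M M′ N N′} → M ≅ M′ → N ≅ N′ → M ∥ N ≅ M′ ∥ N′
    assoc    : ∀ {L M N} → (L ∥ M) ∥ N ≅ L ∥ (M ∥ N)
    comm     : ∀ {M N} → M ∥ N ≅ N ∥ M
    identity : ∀ {N} → N ∥ 𝟘 ≅ N

  -- proc(p, N) = S
  Proc : Loc → NetState → ThreadState → Set
  Proc p N S = ∃[ N′ ] N ≅ p ⟦ S ⟧ ∥ N′

  -- A τ-action records the location that moves, so that the components of a
  -- transition can be read off from its action.
  data Action : Set where
    τ    : Loc → Action
    comm : Loc → Lab → Loc → Action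

  infix 4 _-[_]→_

  data _-[_]→_ : NetState → Action → NetState → Set where
    choice : ∀ {p k N} {bs : Vec (Branch (Thread 0)) (suc k)} {q a P} (i : Fin (suc k)) →
             lookup bs i ≡ (q · a ⟫ P) →
             p ⟦ thread (⊕ bs) ⟧ ∥ N -[ τ p ]→ p ⟦ ⟨ q ! a ⟩ P ⟧ ∥ N
    unfold : ∀ {p N P} →
             p ⟦ thread (μ P) ⟧ ∥ N -[ τ p ]→ p ⟦ thread (P [ μ P /0]) ⟧ ∥ N
    comm   : ∀ {p q a Q k N} {bs : Vec (Branch (Thread 0)) k} {P} (i : Fin k) →
             lookup bs i ≡ (p · a ⟫ P) →
             p ⟦ ⟨ q ! a ⟩ Q ⟧ ∥ q ⟦ thread (Σ? bs) ⟧ ∥ N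
               -[ comm p a q ]→ p ⟦ thread Q ⟧ ∥ q ⟦ thread P ⟧ ∥ N
    struct : ∀ {M M′ N N′ α} → M ≅ M′ → M′ -[ α ]→ N′ → N′ ≅ N → M -[ α ]→ N

  comp : Action → List Loc
  comp (τ p)        = p ∷ []
  comp (comm p a q) = p ∷ q ∷ []

  Involves : Action → Loc → Set
  Involves α p = p ∈ comp α

  Concurrent : Action → Action → Set
  Concurrent α β = Disjoint (comp α) (comp β)

  -- A path consists of the states with index ≤ length and the transitions
  -- with index < length; values of state and action beyond that are junk and
  -- are ignored by all notions below.
  record Path : Set where
    field
      length  : Length
      state   : ℕ → NetState
      action  : ℕ → Action
      step    : ∀ i → i <ᴸ length → state i -[ action i ]→ state (suc i)
      maximal : ∀ n → length ≡ finite n → ¬ (∃[ α ] ∃[ N ] state n -[ α ]→ N)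

  StartsIn : Path → NetState → Set
  StartsIn π N = Path.state π 0 ≅ N

  SuccessfullyTerminates : Loc → Path → Set
  SuccessfullyTerminates p π =
    ∃[ i ] i ≤ᴸ length × Proc p (state i) (thread end)
    where open Path π

  InvolvedInfinitelyOften : Loc → Path → Set
  InvolvedInfinitelyOften p π =
    ∀ m → ∃[ i ] m ≤ i × i <ᴸ length × Involves (action i) p
    where open Path π

  Just : Path → Set
  Just π =
    ∀ m → m ≤ᴸ length → ∀ {α N} → state m -[ α ]→ N →
    ∃[ i ] m ≤ i × i <ᴸ length × ¬ Concurrent α (action i)
    where open Path π

  𝓛 : (Path → Set) → NetState → Set
  𝓛 Fair N = ∀ π → Fair π → StartsIn π N → ∀ p → p ∈ locs N →
             SuccessfullyTerminates p π ⊎ InvolvedInfinitelyOften p π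

  HasRace : NetState → Set
  HasRace N = ∃[ p ] ∃[ a ] ∃[ q ] ∃[ b ] ∃[ r ] ∃[ N′ ] ∃[ N″ ]
    (N -[ comm p a r ]→ N′) × (N -[ comm q b r ]→ N″) × (p ≢ q ⊎ ¬ (N′ ≅ N″))

  Reachable : NetState → NetState → Set
  Reachable = Star (λ M N → ∃[ α ] M -[ α ]→ N)

  RaceFree : NetState → Set
  RaceFree N = ∀ N′ → Reachable N N′ → ¬ HasRace N′

  -- In ⊞ p bs, p is the common sender of the branches and the locations in bs
  -- are the receivers.
  data Global (n : ℕ) : Set where
    end : Global n
    ⊞   : ∀ {k} → Loc → Vec (Branch (Global n)) (suc k) → Global n
    var : Fin n → Global n
    μ   : Global (suc n) → Global n

  data WFᴳ {n : ℕ} : Global n → Set where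
    end : WFᴳ end
    ⊞   : ∀ {k p} {bs : Vec (Branch (Global n)) (suc k)} →
          (∀ i → p ≢ loc (lookup bs i)) →
          (∀ i → WFᴳ (cont (lookup bs i))) → WFᴳ (⊞ p bs)
    var : ∀ {x} → WFᴳ (var x)
    μ   : ∀ {G} → G ≢ var zero → (∀ G′ → G ≢ μ G′) → WFᴳ G → WFᴳ (μ G)

  pt  : ∀ {n} → Global n → List Loc
  ptᵇ : ∀ {n k} → Loc → Vec (Branch (Global n)) k → List Loc
  pt end      = []
  pt (⊞ p bs) = ptᵇ p bs
  pt (var x)  = []
  pt (μ G)    = pt G
  ptᵇ p []                 = []
  ptᵇ p ((q · a ⟫ G) ∷ bs) = p ∷ q ∷ pt G ++ ptᵇ p bs

  -- The free variables; an element of Global n may be closed even if n > 0.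
  fv  : ∀ {n} → Global n → Subset n
  fvᵇ : ∀ {n k} → Vec (Branch (Global n)) k → Subset n
  fv end      = ⊥
  fv (⊞ p bs) = fvᵇ bs
  fv (var x)  = ⁅ x ⁆
  fv (μ G)    = tail (fv G)
  fvᵇ []                 = ⊥
  fvᵇ ((q · a ⟫ G) ∷ bs) = fv G ∪ fvᵇ bs

  Closed : ∀ {n} → Global n → Set
  Closed G = Empty (fv G)

  closed? : ∀ {n} (G : Global n) → Dec (Closed G)
  closed? G = ¬? (nonempty? (fv G))

  data Proj (n : ℕ) : Set where
    end : Proj n
    ⊕   : ∀ {k} → Vec (Branch (Proj n)) (suc k) → Proj n
    ¿   : Branch (Proj n) → Proj n
    ⊓   : ∀ {k} → Vec (Proj n) (suc k) → Proj n
    var : Fin n → Proj n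
    μ   : Proj (suc n) → Proj n

  renᴾ  : ∀ {m n} → (Fin m → Fin n) → Proj m → Proj n
  renᴾᵇ : ∀ {m n k} → (Fin m → Fin n) →
          Vec (Branch (Proj m)) k → Vec (Branch (Proj n)) k
  renᴾᵛ : ∀ {m n k} → (Fin m → Fin n) → Vec (Proj m) k → Vec (Proj n) k
  renᴾ ρ end             = end
  renᴾ ρ (⊕ bs)          = ⊕ (renᴾᵇ ρ bs)
  renᴾ ρ (¿ (p · a ⟫ Q)) = ¿ (p · a ⟫ renᴾ ρ Q)
  renᴾ ρ (⊓ Qs)          = ⊓ (renᴾᵛ ρ Qs)
  renᴾ ρ (var x)         = var (ρ x)
  renᴾ ρ (μ Q)           = μ (renᴾ (liftᵣ ρ) Q)
  renᴾᵇ ρ []                 = []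
  renᴾᵇ ρ ((p · a ⟫ Q) ∷ bs) = (p · a ⟫ renᴾ ρ Q) ∷ renᴾᵇ ρ bs
  renᴾᵛ ρ []       = []
  renᴾᵛ ρ (Q ∷ Qs) = renᴾ ρ Q ∷ renᴾᵛ ρ Qs

  liftᴾ : ∀ {m n} → (Fin m → Proj n) → Fin (suc m) → Proj (suc n)
  liftᴾ σ zero    = var zero
  liftᴾ σ (suc x) = renᴾ suc (σ x)

  subᴾ  : ∀ {m n} → (Fin m → Proj n) → Proj m → Proj n
  subᴾᵇ : ∀ {m n k} → (Fin m → Proj n) →
          Vec (Branch (Proj m)) k → Vec (Branch (Proj n)) k
  subᴾᵛ : ∀ {m n k} → (Fin m → Proj n) → Vec (Proj m) k → Vec (Proj n) k
  subᴾ σ end             = end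
  subᴾ σ (⊕ bs)          = ⊕ (subᴾᵇ σ bs)
  subᴾ σ (¿ (p · a ⟫ Q)) = ¿ (p · a ⟫ subᴾ σ Q)
  subᴾ σ (⊓ Qs)          = ⊓ (subᴾᵛ σ Qs)
  subᴾ σ (var x)         = σ x
  subᴾ σ (μ Q)           = μ (subᴾ (liftᴾ σ) Q)
  subᴾᵇ σ []                 = []
  subᴾᵇ σ ((p · a ⟫ Q) ∷ bs) = (p · a ⟫ subᴾ σ Q) ∷ subᴾᵇ σ bs
  subᴾᵛ σ []       = []
  subᴾᵛ σ (Q ∷ Qs) = subᴾ σ Q ∷ subᴾᵛ σ Qs

  singleᴾ : ∀ {n} → Proj n → Fin (suc n) → Proj n
  singleᴾ Q zero    = Q
  singleᴾ Q (suc x) = var x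

  _[_/0]ᴾ : ∀ {n} → Proj (suc n) → Proj n → Proj n
  Q [ R /0]ᴾ = subᴾ (singleᴾ R) Q

  -- The merge of a single projection is that projection, so that the clause
  -- for a choice agrees with the clause for a single branch when |I| = 1.
  ⨅ : ∀ {n k} → Vec (Proj n) (suc k) → Proj n
  ⨅ (Q ∷ [])         = Q
  ⨅ Qs@(_ ∷ (_ ∷ _)) = ⊓ Qs

  infix 6 _↾_

  -- projSends: the branches qᵢ!λᵢ;(Gᵢ↾r), used when r is the sender;
  -- projBranches: the projections of the single branches p→qᵢ:λᵢ;Gᵢ on r,
  -- used when r is not the sender p.
  _↾_          : ∀ {n} → Global n → Loc → Proj n
  projSends    : ∀ {n k} → Vec (Branch (Global n)) k → Loc → Vec (Branch (Proj n)) k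
  projBranches : ∀ {n k} → Loc → Vec (Branch (Global n)) k → Loc → Vec (Proj n) k
  end ↾ r    = end
  ⊞ p bs ↾ r = if does (r ≟ p) then ⊕ (projSends bs r) else ⨅ (projBranches p bs r)
  var x ↾ r  = var x
  μ G ↾ r    = if does (¬? (r ∈? pt G) ×-dec closed? (μ G)) then end else μ (G ↾ r)
  projSends []                 r = []
  projSends ((q · a ⟫ G) ∷ bs) r = (q · a ⟫ (G ↾ r)) ∷ projSends bs r
  projBranches p []                 r = []
  projBranches p ((q · a ⟫ G) ∷ bs) r =
    (if does (r ≟ q) then ¿ (p · a ⟫ (G ↾ r)) else G ↾ r) ∷ projBranches p bs r

  -- The rules of the judgement P ⊢ Q, with premises taken in R.
  -- In rule ⊕, the inclusion I ⊆ J of index sets is the injection f.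
  data Rule (R : ThreadState → Proj 0 → Set) : ThreadState → Proj 0 → Set where
    μˡ  : ∀ {P Q} → R (thread (P [ μ P /0])) Q → Rule R (thread (μ P)) Q
    μʳ  : ∀ {S Q} → R S (Q [ μ Q /0]ᴾ) → Rule R S (μ Q)
    end : Rule R (thread end) end
    ¿   : ∀ {k p a P Q} {bs : Vec (Branch (Thread 0)) k} (i : Fin k) →
          lookup bs i ≡ (p · a ⟫ P) → R (thread P) Q →
          Rule R (thread (Σ? bs)) (¿ (p · a ⟫ Q))
    ⊕   : ∀ {k l} {bs : Vec (Branch (Thread 0)) (suc k)} {cs : Vec (Branch (Proj 0)) (suc l)}
          (f : Fin (suc k) → Fin (suc l)) → Injective _≡_ _≡_ f →
          (∀ i → loc (lookup bs i) ≡ loc (lookup cs (f i))) →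
          (∀ i → label (lookup bs i) ≡ label (lookup cs (f i))) →
          (∀ i → R (thread (cont (lookup bs i))) (cont (lookup cs (f i)))) →
          Rule R (thread (⊕ bs)) (⊕ cs)
    ⊓   : ∀ {S k} {Qs : Vec (Proj 0) (suc k)} →
          (∀ i → R S (lookup Qs i)) → Rule R S (⊓ Qs)
    sel : ∀ {l q a P Q} {cs : Vec (Branch (Proj 0)) (suc l)} (k : Fin (suc l)) →
          lookup cs k ≡ (q · a ⟫ Q) → R (thread P) Q →
          Rule R (⟨ q ! a ⟩ P) (⊕ cs)

  infix 4 _⊢_ _⊢ᴳ_ _⊢ᵍ_

  -- The coinductive reading of the rules: the union of all relations in which
  -- every pair is the conclusion of a rule with premises in the relation.
  _⊢_ : ThreadState → Proj 0 → Set₁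
  S ⊢ Q = ∃[ R ] (∀ {S′ Q′} → R S′ Q′ → Rule R S′ Q′) × R S Q

  -- x occurs in Q outside of all subexpressions p!λ;Q′ and p?λ;Q′ of Q.
  data ExposedIn : ∀ {n} → Fin n → Proj n → Set where
    var : ∀ {n} {x : Fin n} → ExposedIn x (var x)
    ⊓   : ∀ {n k} {x : Fin n} {Qs : Vec (Proj n) (suc k)} (i : Fin (suc k)) →
          ExposedIn x (lookup Qs i) → ExposedIn x (⊓ Qs)
    μ   : ∀ {n} {x : Fin n} {Q} → ExposedIn (suc x) Q → ExposedIn x (μ Q)

  data Guarded {n : ℕ} : Proj n → Set where
    end : Guarded end
    ⊕   : ∀ {k} {bs : Vec (Branch (Proj n)) (suc k)} →
          (∀ i → Guarded (cont (lookup bs i))) → Guarded (⊕ bs)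
    ¿   : ∀ {b} → Guarded (cont b) → Guarded (¿ b)
    ⊓   : ∀ {k} {Qs : Vec (Proj n) (suc k)} →
          (∀ i → Guarded (lookup Qs i)) → Guarded (⊓ Qs)
    var : ∀ {x} → Guarded (var x)
    μ   : ∀ {Q} → ¬ ExposedIn zero Q → Guarded Q → Guarded (μ Q)

  _⊢ᴳ_ : NetState → Global 0 → Set₁
  N ⊢ᴳ G = pt G ⊆ locs N × (∀ p S → Proc p N S → S ⊢ G ↾ p)

  _⊢ᵍ_ : NetState → Global 0 → Set₁
  N ⊢ᵍ G = N ⊢ᴳ G × (∀ p → p ∈ locs N → Guarded (G ↾ p))

  GuardedlyWellTyped : NetState → Set₁
  GuardedlyWellTyped N = ∃[ G ] WFᴳ G × N ⊢ᵍ G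

{-# OPTIONS --safe #-}

-- Let p → q be the head of a global type of the network.  On a just path, p
-- selects a branch, q becomes ready to receive, and race-freedom forces q to
-- receive from p.  These transitions are concurrent with those before them, so
-- they may be moved to the front of the path; then the network is typed by the
-- continuation of the branch.  Hence typing need not be preserved by transitions
-- that do not belong to the head.  By guardedness, the part of G ↾ r above the
-- first send or receive of r is finite, so every location r occurring in G is
-- reached in this way.  To obtain a transition of r at position m or later,
-- count the transitions before position m: moving one of them to the front
-- lowers their number.

module Submission where

open import Defs
open import Level using (0ℓ)
open import Axiom.ExcludedMiddle using (ExcludedMiddle)
open import Relation.Binary.PropositionalEquality using (_≡_)
open import Data.Bool using (if_then_else_)
open import Data.Empty using (⊥-elim)
open import Data.Fin using (Fin; zero; suc)
import Data.Fin.Subset as Subset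
open import Data.Fin.Subset.Properties using (x∈⁅x⁆; x∈p∪q⁺)
open import Data.List using (List; []; _∷_; map)
import Data.List.Membership.DecPropositional as DecMembership
open import Data.List.Membership.Propositional using (_∈_; _∉_)
open import Data.List.Membership.Propositional.Properties using (∈-++⁺ˡ; ∈-++⁺ʳ; ∈-++⁻; ∈-map⁺)
open import Data.List.Relation.Binary.Permutation.Propositional
  using (_↭_; ↭-refl; ↭-sym; ↭-trans; ↭⇒↭ₛ)
import Data.List.Relation.Binary.Permutation.Propositional.Properties as ↭
import Data.List.Relation.Binary.Permutation.Setoid.Properties as ↭ₛ
open import Data.List.Relation.Binary.Subset.Propositional using (_⊆_)
open import Data.List.Relation.Unary.All as All using (_∷_)
open import Data.List.Relation.Unary.AllPairs using (_∷_)
open import Data.List.Relation.Unary.Any using (here; there)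
open import Data.List.Relation.Unary.Unique.Propositional using (Unique)
open import Data.Maybe using (Maybe; just; nothing)
open import Data.Maybe.Properties using (just-injective)
open import Data.Nat using (ℕ; zero; suc; _⊔_; _≤_; _<_; z≤n; s≤s; _+_)
import Data.Nat as Nat
import Data.Nat.Properties as ℕ
open import Data.Product using (∃; ∃-syntax; _×_; _,_; proj₁; proj₂)
open import Data.Sum using (_⊎_; inj₁; inj₂; [_,_]′)
open import Data.Unit using (tt)
import Data.Vec as Vec
open import Data.Vec using (Vec; []; _∷_; lookup; tail)
open import Function using (_∘_; case_of_; id)
open import Relation.Binary using (tri<; tri≈; tri>)
open import Relation.Binary.Construct.Closure.ReflexiveTransitive using (_◅_; ε)
open import Relation.Binary.PropositionalEquality as ≡ using (_≢_; refl)
open import Relation.Nullary using (¬_; Dec; does; yes; no; ¬?; _×-dec_)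

-- The induction is lexicographic. Its first component is the count of transitions before `m`; when
-- a transition is taken from there, the other components may become arbitrarily large. A transition
-- taken from `m` or later either involves `p`, which ends the proof, or it does not, and then the
-- second component, the nesting of recursions above the first send or receive in the projection on
-- `p`, does not grow. The third component is the structure of the global type, kept as a closure:
-- passing to a branch or to the closure of a variable is structural, and only the body of a
-- recursion, whose environment contains that recursion itself, needs the second component to drop.
-- Two obstacles shape the rest. The position `m` must keep its meaning while transitions are moved,
-- so a vacated position becomes an idle step. And the reordered run visits other states than the
-- path, so justness has to be proved anew after each move.

module Development (em : ExcludedMiddle 0ℓ) (Loc Lab : Set) where

  open Session Loc Lab (λ p q → em {p ≡ q})
  open DecMembership (λ (p q : Loc) → em {p ≡ q}) using (_∈?_)

  -- Substitution in projection types

  lookup-renᴾᵛ : ∀ {m n k} (ρ : Fin m → Fin n) (Qs : Vec (Proj m) k) i →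
                 lookup (renᴾᵛ ρ Qs) i ≡ renᴾ ρ (lookup Qs i)
  lookup-renᴾᵛ ρ (Q ∷ Qs) zero    = refl
  lookup-renᴾᵛ ρ (Q ∷ Qs) (suc i) = lookup-renᴾᵛ ρ Qs i

  lookup-subᴾᵛ : ∀ {m n k} (σ : Fin m → Proj n) (Qs : Vec (Proj m) k) i →
                 lookup (subᴾᵛ σ Qs) i ≡ subᴾ σ (lookup Qs i)
  lookup-subᴾᵛ σ (Q ∷ Qs) zero    = refl
  lookup-subᴾᵛ σ (Q ∷ Qs) (suc i) = lookup-subᴾᵛ σ Qs i

  liftᵣ-∘ : ∀ {l m n} {ρ : Fin l → Fin m} {ρ′ : Fin m → Fin n} {ρ″ : Fin l → Fin n} →
            (∀ x → ρ′ (ρ x) ≡ ρ″ x) → ∀ x → liftᵣ ρ′ (liftᵣ ρ x) ≡ liftᵣ ρ″ x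
  liftᵣ-∘ eq zero    = refl
  liftᵣ-∘ eq (suc x) = ≡.cong suc (eq x)

  renᴾ-renᴾ  : ∀ {l m n} {ρ : Fin l → Fin m} {ρ′ : Fin m → Fin n} {ρ″ : Fin l → Fin n} →
               (∀ x → ρ′ (ρ x) ≡ ρ″ x) → ∀ Q → renᴾ ρ′ (renᴾ ρ Q) ≡ renᴾ ρ″ Q
  renᴾᵇ-renᴾᵇ : ∀ {l m n k} {ρ : Fin l → Fin m} {ρ′ : Fin m → Fin n} {ρ″ : Fin l → Fin n} →
               (∀ x → ρ′ (ρ x) ≡ ρ″ x) → ∀ (bs : Vec (Branch (Proj l)) k) →
               renᴾᵇ ρ′ (renᴾᵇ ρ bs) ≡ renᴾᵇ ρ″ bs
  renᴾᵛ-renᴾᵛ : ∀ {l m n k} {ρ : Fin l → Fin m} {ρ′ : Fin m → Fin n} {ρ″ : Fin l → Fin n} →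
               (∀ x → ρ′ (ρ x) ≡ ρ″ x) → ∀ (Qs : Vec (Proj l) k) →
               renᴾᵛ ρ′ (renᴾᵛ ρ Qs) ≡ renᴾᵛ ρ″ Qs
  renᴾ-renᴾ eq end             = refl
  renᴾ-renᴾ eq (⊕ bs)          = ≡.cong ⊕ (renᴾᵇ-renᴾᵇ eq bs)
  renᴾ-renᴾ eq (¿ (p · a ⟫ Q)) = ≡.cong (λ Q → ¿ (p · a ⟫ Q)) (renᴾ-renᴾ eq Q)
  renᴾ-renᴾ eq (⊓ Qs)          = ≡.cong ⊓ (renᴾᵛ-renᴾᵛ eq Qs)
  renᴾ-renᴾ eq (var x)         = ≡.cong var (eq x)
  renᴾ-renᴾ eq (μ Q)           = ≡.cong μ (renᴾ-renᴾ (liftᵣ-∘ eq) Q)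
  renᴾᵇ-renᴾᵇ eq []                 = refl
  renᴾᵇ-renᴾᵇ eq ((p · a ⟫ Q) ∷ bs) =
    ≡.cong₂ (λ Q bs → (p · a ⟫ Q) ∷ bs) (renᴾ-renᴾ eq Q) (renᴾᵇ-renᴾᵇ eq bs)
  renᴾᵛ-renᴾᵛ eq []       = refl
  renᴾᵛ-renᴾᵛ eq (Q ∷ Qs) = ≡.cong₂ _∷_ (renᴾ-renᴾ eq Q) (renᴾᵛ-renᴾᵛ eq Qs)

  liftᴾ-liftᵣ : ∀ {l m n} {ρ : Fin l → Fin m} {σ : Fin m → Proj n} {υ : Fin l → Proj n} →
                (∀ x → σ (ρ x) ≡ υ x) → ∀ x → liftᴾ σ (liftᵣ ρ x) ≡ liftᴾ υ x
  liftᴾ-liftᵣ eq zero    = refl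
  liftᴾ-liftᵣ eq (suc x) = ≡.cong (renᴾ suc) (eq x)

  subᴾ-renᴾ  : ∀ {l m n} {ρ : Fin l → Fin m} {σ : Fin m → Proj n} {υ : Fin l → Proj n} →
               (∀ x → σ (ρ x) ≡ υ x) → ∀ Q → subᴾ σ (renᴾ ρ Q) ≡ subᴾ υ Q
  subᴾᵇ-renᴾᵇ : ∀ {l m n k} {ρ : Fin l → Fin m} {σ : Fin m → Proj n} {υ : Fin l → Proj n} →
               (∀ x → σ (ρ x) ≡ υ x) → ∀ (bs : Vec (Branch (Proj l)) k) →
               subᴾᵇ σ (renᴾᵇ ρ bs) ≡ subᴾᵇ υ bs
  subᴾᵛ-renᴾᵛ : ∀ {l m n k} {ρ : Fin l → Fin m} {σ : Fin m → Proj n} {υ : Fin l → Proj n} →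
               (∀ x → σ (ρ x) ≡ υ x) → ∀ (Qs : Vec (Proj l) k) →
               subᴾᵛ σ (renᴾᵛ ρ Qs) ≡ subᴾᵛ υ Qs
  subᴾ-renᴾ eq end             = refl
  subᴾ-renᴾ eq (⊕ bs)          = ≡.cong ⊕ (subᴾᵇ-renᴾᵇ eq bs)
  subᴾ-renᴾ eq (¿ (p · a ⟫ Q)) = ≡.cong (λ Q → ¿ (p · a ⟫ Q)) (subᴾ-renᴾ eq Q)
  subᴾ-renᴾ eq (⊓ Qs)          = ≡.cong ⊓ (subᴾᵛ-renᴾᵛ eq Qs)
  subᴾ-renᴾ eq (var x)         = eq x
  subᴾ-renᴾ eq (μ Q)           = ≡.cong μ (subᴾ-renᴾ (liftᴾ-liftᵣ eq) Q)
  subᴾᵇ-renᴾᵇ eq []                 = refl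
  subᴾᵇ-renᴾᵇ eq ((p · a ⟫ Q) ∷ bs) =
    ≡.cong₂ (λ Q bs → (p · a ⟫ Q) ∷ bs) (subᴾ-renᴾ eq Q) (subᴾᵇ-renᴾᵇ eq bs)
  subᴾᵛ-renᴾᵛ eq []       = refl
  subᴾᵛ-renᴾᵛ eq (Q ∷ Qs) = ≡.cong₂ _∷_ (subᴾ-renᴾ eq Q) (subᴾᵛ-renᴾᵛ eq Qs)

  renᴾ-liftᴾ : ∀ {l m n} {σ : Fin l → Proj m} {ρ : Fin m → Fin n} {υ : Fin l → Proj n} →
               (∀ x → renᴾ ρ (σ x) ≡ υ x) → ∀ x → renᴾ (liftᵣ ρ) (liftᴾ σ x) ≡ liftᴾ υ x
  renᴾ-liftᴾ eq zero = refl
  renᴾ-liftᴾ {σ = σ} eq (suc x) =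
    ≡.trans (renᴾ-renᴾ (λ _ → refl) (σ x))
      (≡.trans (≡.sym (renᴾ-renᴾ (λ _ → refl) (σ x))) (≡.cong (renᴾ suc) (eq x)))

  renᴾ-subᴾ  : ∀ {l m n} {σ : Fin l → Proj m} {ρ : Fin m → Fin n} {υ : Fin l → Proj n} →
               (∀ x → renᴾ ρ (σ x) ≡ υ x) → ∀ Q → renᴾ ρ (subᴾ σ Q) ≡ subᴾ υ Q
  renᴾᵇ-subᴾᵇ : ∀ {l m n k} {σ : Fin l → Proj m} {ρ : Fin m → Fin n} {υ : Fin l → Proj n} →
               (∀ x → renᴾ ρ (σ x) ≡ υ x) → ∀ (bs : Vec (Branch (Proj l)) k) →
               renᴾᵇ ρ (subᴾᵇ σ bs) ≡ subᴾᵇ υ bs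
  renᴾᵛ-subᴾᵛ : ∀ {l m n k} {σ : Fin l → Proj m} {ρ : Fin m → Fin n} {υ : Fin l → Proj n} →
               (∀ x → renᴾ ρ (σ x) ≡ υ x) → ∀ (Qs : Vec (Proj l) k) →
               renᴾᵛ ρ (subᴾᵛ σ Qs) ≡ subᴾᵛ υ Qs
  renᴾ-subᴾ eq end             = refl
  renᴾ-subᴾ eq (⊕ bs)          = ≡.cong ⊕ (renᴾᵇ-subᴾᵇ eq bs)
  renᴾ-subᴾ eq (¿ (p · a ⟫ Q)) = ≡.cong (λ Q → ¿ (p · a ⟫ Q)) (renᴾ-subᴾ eq Q)
  renᴾ-subᴾ eq (⊓ Qs)          = ≡.cong ⊓ (renᴾᵛ-subᴾᵛ eq Qs)
  renᴾ-subᴾ eq (var x)         = eq x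
  renᴾ-subᴾ eq (μ Q)           = ≡.cong μ (renᴾ-subᴾ (renᴾ-liftᴾ eq) Q)
  renᴾᵇ-subᴾᵇ eq []                 = refl
  renᴾᵇ-subᴾᵇ eq ((p · a ⟫ Q) ∷ bs) =
    ≡.cong₂ (λ Q bs → (p · a ⟫ Q) ∷ bs) (renᴾ-subᴾ eq Q) (renᴾᵇ-subᴾᵇ eq bs)
  renᴾᵛ-subᴾᵛ eq []       = refl
  renᴾᵛ-subᴾᵛ eq (Q ∷ Qs) = ≡.cong₂ _∷_ (renᴾ-subᴾ eq Q) (renᴾᵛ-subᴾᵛ eq Qs)

  subᴾ-liftᴾ : ∀ {l m n} {σ : Fin l → Proj m} {τ : Fin m → Proj n} {υ : Fin l → Proj n} →
               (∀ x → subᴾ τ (σ x) ≡ υ x) → ∀ x → subᴾ (liftᴾ τ) (liftᴾ σ x) ≡ liftᴾ υ x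
  subᴾ-liftᴾ eq zero = refl
  subᴾ-liftᴾ {σ = σ} eq (suc x) =
    ≡.trans (subᴾ-renᴾ (λ _ → refl) (σ x))
      (≡.trans (≡.sym (renᴾ-subᴾ (λ _ → refl) (σ x))) (≡.cong (renᴾ suc) (eq x)))

  subᴾ-subᴾ  : ∀ {l m n} {σ : Fin l → Proj m} {τ : Fin m → Proj n} {υ : Fin l → Proj n} →
               (∀ x → subᴾ τ (σ x) ≡ υ x) → ∀ Q → subᴾ τ (subᴾ σ Q) ≡ subᴾ υ Q
  subᴾᵇ-subᴾᵇ : ∀ {l m n k} {σ : Fin l → Proj m} {τ : Fin m → Proj n} {υ : Fin l → Proj n} →
               (∀ x → subᴾ τ (σ x) ≡ υ x) → ∀ (bs : Vec (Branch (Proj l)) k) →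
               subᴾᵇ τ (subᴾᵇ σ bs) ≡ subᴾᵇ υ bs
  subᴾᵛ-subᴾᵛ : ∀ {l m n k} {σ : Fin l → Proj m} {τ : Fin m → Proj n} {υ : Fin l → Proj n} →
               (∀ x → subᴾ τ (σ x) ≡ υ x) → ∀ (Qs : Vec (Proj l) k) →
               subᴾᵛ τ (subᴾᵛ σ Qs) ≡ subᴾᵛ υ Qs
  subᴾ-subᴾ eq end             = refl
  subᴾ-subᴾ eq (⊕ bs)          = ≡.cong ⊕ (subᴾᵇ-subᴾᵇ eq bs)
  subᴾ-subᴾ eq (¿ (p · a ⟫ Q)) = ≡.cong (λ Q → ¿ (p · a ⟫ Q)) (subᴾ-subᴾ eq Q)
  subᴾ-subᴾ eq (⊓ Qs)          = ≡.cong ⊓ (subᴾᵛ-subᴾᵛ eq Qs)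
  subᴾ-subᴾ eq (var x)         = eq x
  subᴾ-subᴾ eq (μ Q)           = ≡.cong μ (subᴾ-subᴾ (subᴾ-liftᴾ eq) Q)
  subᴾᵇ-subᴾᵇ eq []                 = refl
  subᴾᵇ-subᴾᵇ eq ((p · a ⟫ Q) ∷ bs) =
    ≡.cong₂ (λ Q bs → (p · a ⟫ Q) ∷ bs) (subᴾ-subᴾ eq Q) (subᴾᵇ-subᴾᵇ eq bs)
  subᴾᵛ-subᴾᵛ eq []       = refl
  subᴾᵛ-subᴾᵛ eq (Q ∷ Qs) = ≡.cong₂ _∷_ (subᴾ-subᴾ eq Q) (subᴾᵛ-subᴾᵛ eq Qs)

  liftᴾ-var : ∀ {n} {σ : Fin n → Proj n} → (∀ x → σ x ≡ var x) → ∀ x → liftᴾ σ x ≡ var x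
  liftᴾ-var eq zero    = refl
  liftᴾ-var eq (suc x) = ≡.cong (renᴾ suc) (eq x)

  subᴾ-var  : ∀ {n} {σ : Fin n → Proj n} → (∀ x → σ x ≡ var x) → ∀ Q → subᴾ σ Q ≡ Q
  subᴾᵇ-var : ∀ {n k} {σ : Fin n → Proj n} → (∀ x → σ x ≡ var x) →
              ∀ (bs : Vec (Branch (Proj n)) k) → subᴾᵇ σ bs ≡ bs
  subᴾᵛ-var : ∀ {n k} {σ : Fin n → Proj n} → (∀ x → σ x ≡ var x) →
              ∀ (Qs : Vec (Proj n) k) → subᴾᵛ σ Qs ≡ Qs
  subᴾ-var eq end             = refl
  subᴾ-var eq (⊕ bs)          = ≡.cong ⊕ (subᴾᵇ-var eq bs)
  subᴾ-var eq (¿ (p · a ⟫ Q)) = ≡.cong (λ Q → ¿ (p · a ⟫ Q)) (subᴾ-var eq Q)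
  subᴾ-var eq (⊓ Qs)          = ≡.cong ⊓ (subᴾᵛ-var eq Qs)
  subᴾ-var eq (var x)         = eq x
  subᴾ-var eq (μ Q)           = ≡.cong μ (subᴾ-var (liftᴾ-var eq) Q)
  subᴾᵇ-var eq []                 = refl
  subᴾᵇ-var eq ((p · a ⟫ Q) ∷ bs) =
    ≡.cong₂ (λ Q bs → (p · a ⟫ Q) ∷ bs) (subᴾ-var eq Q) (subᴾᵇ-var eq bs)
  subᴾᵛ-var eq []       = refl
  subᴾᵛ-var eq (Q ∷ Qs) = ≡.cong₂ _∷_ (subᴾ-var eq Q) (subᴾᵛ-var eq Qs)

  -- This is why closures can replace substitution: unfolding an instantiated recursion amounts to
  -- extending the environment by one entry.
  unfold-subᴾ : ∀ {n} {σ : Fin n → Proj 0} {σ′ : Fin (suc n) → Proj 0} →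
                (∀ x → σ′ (suc x) ≡ σ x) → ∀ Q →
                subᴾ (liftᴾ σ) Q [ σ′ zero /0]ᴾ ≡ subᴾ σ′ Q
  unfold-subᴾ {σ = σ} {σ′} eq = subᴾ-subᴾ λ where
    zero    → refl
    (suc x) → ≡.trans (subᴾ-renᴾ (λ ()) (σ x))
                (≡.trans (subᴾ-var {σ = var} (λ _ → refl) (σ x)) (≡.sym (eq x)))

  -- The typing judgement

  mapRule : ∀ {R R′ : ThreadState → Proj 0 → Set} → (∀ {S Q} → R S Q → R′ S Q) →
            ∀ {S Q} → Rule R S Q → Rule R′ S Q
  mapRule f (μˡ r)            = μˡ (f r)
  mapRule f (μʳ r)            = μʳ (f r)
  mapRule f end               = end
  mapRule f (¿ i eq r)        = ¿ i eq (f r)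
  mapRule f (⊕ g inj ls as r) = ⊕ g inj ls as (f ∘ r)
  mapRule f (⊓ r)             = ⊓ (f ∘ r)
  mapRule f (sel k eq r)      = sel k eq (f r)

  -- The coinduction principle for the lemmas below. The witness is the union of `X` and `R`, so a
  -- step out of `X` may fall back into the derivation that was given.
  ⊢-upto : (X : ThreadState → Proj 0 → Set) {R : ThreadState → Proj 0 → Set} →
           (∀ {S Q} → R S Q → Rule R S Q) →
           (∀ {S Q} → X S Q → Rule (λ S Q → X S Q ⊎ R S Q) S Q) →
           ∀ {S Q} → X S Q → S ⊢ Q
  ⊢-upto X post step x = _ , [ step , mapRule inj₂ ∘ post ]′ , inj₁ x

  data τStep : ThreadState → ThreadState → Set where
    choice : ∀ {k} {bs : Vec (Branch (Thread 0)) (suc k)} {q a P} (i : Fin (suc k)) →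
             lookup bs i ≡ (q · a ⟫ P) → τStep (thread (⊕ bs)) (⟨ q ! a ⟩ P)
    unfold : ∀ {P} → τStep (thread (μ P)) (thread (P [ μ P /0]))

  -- The rules `μʳ` and `⊓` leave the thread state alone, so the step commutes with them. Any other
  -- rule must match the step: `μˡ` already contains the unfolding, and `⊕` becomes `sel` at the
  -- index `f i`.
  τ-⊢ : ∀ {S S′ Q} → τStep S S′ → S ⊢ Q → S′ ⊢ Q
  τ-⊢ t (R , post , r) = ⊢-upto X post (λ (_ , t , r) → go t (post r)) (_ , t , r)
    where
    X : ThreadState → Proj 0 → Set
    X S′ Q = ∃[ S ] τStep S S′ × R S Q
    go : ∀ {S S′ Q} → τStep S S′ → Rule R S Q → Rule (λ S Q → X S Q ⊎ R S Q) S′ Q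
    go t              (μʳ r)               = μʳ (inj₁ (_ , t , r))
    go t              (⊓ r)                = ⊓ (λ i → inj₁ (_ , t , r i))
    go unfold         (μˡ r)               = mapRule inj₂ (post r)
    go (choice i eq) (⊕ {cs = cs} f _ ls as r) with lookup cs (f i) in eq′ | ls i | as i | r i
    ... | _ · _ ⟫ _ | l | a | r rewrite eq | l | a = sel (f i) eq′ (inj₂ r)

  -- A derivation may unfold the thread, even forever, before it uses `⊓`. Hence the inversion is
  -- itself coinductive; the same holds for `⊢-μ`.
  ⊢-⊓ : ∀ {S k} {Qs : Vec (Proj 0) (suc k)} → S ⊢ ⊓ Qs → ∀ i → S ⊢ lookup Qs i
  ⊢-⊓ {Qs = Qs} (R , post , r) i =
    ⊢-upto X post (λ { (refl , r) → go (post r) }) (refl , r)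
    where
    X : ThreadState → Proj 0 → Set
    X S Q = Q ≡ lookup Qs i × R S (⊓ Qs)
    go : ∀ {S} → Rule R S (⊓ Qs) → Rule (λ S Q → X S Q ⊎ R S Q) S (lookup Qs i)
    go (μˡ r) = μˡ (inj₁ (refl , r))
    go (⊓ r)  = mapRule inj₂ (post (r i))

  ⊢-⨅ : ∀ {S k} (Qs : Vec (Proj 0) (suc k)) → S ⊢ ⨅ Qs → ∀ i → S ⊢ lookup Qs i
  ⊢-⨅ (_ ∷ [])    t zero = t
  ⊢-⨅ (_ ∷ _ ∷ _) t i    = ⊢-⊓ t i

  ⊢-μ : ∀ {S Q} → S ⊢ μ Q → S ⊢ Q [ μ Q /0]ᴾ
  ⊢-μ {Q = Q} (R , post , r) =
    ⊢-upto X post (λ { (refl , r) → go (post r) }) (refl , r)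
    where
    X : ThreadState → Proj 0 → Set
    X S Q′ = Q′ ≡ Q [ μ Q /0]ᴾ × R S (μ Q)
    go : ∀ {S} → Rule R S (μ Q) → Rule (λ S Q → X S Q ⊎ R S Q) S (Q [ μ Q /0]ᴾ)
    go (μˡ r) = μˡ (inj₁ (refl , r))
    go (μʳ r) = mapRule inj₂ (post r)

  -- Excludes `μˡ` as the last rule, so that the head of the type determines the rule in the three
  -- inversions below. `settle` brings threads into this form.
  NotMu : Thread 0 → Set
  NotMu P = ∀ P′ → P ≢ μ P′

  ⊢-end : ∀ {P} → NotMu P → thread P ⊢ end → P ≡ end
  ⊢-end ¬μ (R , post , r) with post r
  ... | end  = refl
  ... | μˡ _ = ⊥-elim (¬μ _ refl)

  ⊢-⊕ : ∀ {P l} {cs : Vec (Branch (Proj 0)) (suc l)} → NotMu P → thread P ⊢ ⊕ cs →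
        ∃[ k ] ∃ λ (bs : Vec (Branch (Thread 0)) (suc k)) → P ≡ ⊕ bs
  ⊢-⊕ ¬μ (R , post , r) with post r
  ... | ⊕ _ _ _ _ _ = _ , _ , refl
  ... | μˡ _ = ⊥-elim (¬μ _ refl)

  ⊢-¿ : ∀ {P s a Q} → NotMu P → thread P ⊢ ¿ (s · a ⟫ Q) →
        ∃[ k ] ∃ λ (bs : Vec (Branch (Thread 0)) k) → P ≡ Σ? bs ×
        ∃[ i ] ∃[ T ] lookup bs i ≡ (s · a ⟫ T) × thread T ⊢ Q
  ⊢-¿ ¬μ (R , post , r) with post r
  ... | ¿ i eq r′ = _ , _ , refl , i , _ , eq , R , post , r′
  ... | μˡ _ = ⊥-elim (¬μ _ refl)

  -- The projection of μX.G on a location that does not occur in it is end,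
  -- but that of its unfolding may contain merges and recursions.
  data Silent {n : ℕ} : Proj n → Set where
    end : Silent end
    ⊓   : ∀ {k} {Qs : Vec (Proj n) (suc k)} → (∀ i → Silent (lookup Qs i)) → Silent (⊓ Qs)
    var : ∀ {x} → Silent (var x)
    μ   : ∀ {Q} → Silent Q → Silent (μ Q)

  Silent-renᴾ : ∀ {m n} {ρ : Fin m → Fin n} {Q} → Silent Q → Silent (renᴾ ρ Q)
  Silent-renᴾ end    = end
  Silent-renᴾ {ρ = ρ} (⊓ {Qs = Qs} s) =
    ⊓ λ i → ≡.subst Silent (≡.sym (lookup-renᴾᵛ ρ Qs i)) (Silent-renᴾ (s i))
  Silent-renᴾ var    = var
  Silent-renᴾ (μ s)  = μ (Silent-renᴾ s)

  Silent-subᴾ : ∀ {m n} {σ : Fin m → Proj n} {Q} → Silent Q →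
                (∀ x → Silent (σ x)) → Silent (subᴾ σ Q)
  Silent-subᴾ end    sσ = end
  Silent-subᴾ {σ = σ} (⊓ {Qs = Qs} s) sσ =
    ⊓ λ i → ≡.subst Silent (≡.sym (lookup-subᴾᵛ σ Qs i)) (Silent-subᴾ (s i) sσ)
  Silent-subᴾ var    sσ = sσ _
  Silent-subᴾ (μ s)  sσ = μ (Silent-subᴾ s λ { zero → var ; (suc x) → Silent-renᴾ (sσ x) })

  -- The typing by `end` is carried along while `⊓` and `μʳ` take the type apart. Coinduction also
  -- covers types such as `μ (var zero)`, where this never stops.
  ⊢-Silent : ∀ {S Q} → S ⊢ end → Silent Q → S ⊢ Q
  ⊢-Silent (R , post , r) s = ⊢-upto X post (λ (r , s) → go r s) (r , s)
    where
    X : ThreadState → Proj 0 → Set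
    X S Q = R S end × Silent Q
    go : ∀ {S Q} → R S end → Silent Q → Rule (λ S Q → X S Q ⊎ R S Q) S Q
    go r end   = mapRule inj₂ (post r)
    go r (⊓ s) = ⊓ λ i → inj₁ (r , s i)
    go r (μ s) = μʳ (inj₁ (r , Silent-subᴾ s λ { zero → μ s }))

  Silent-⨅ : ∀ {n k} {Qs : Vec (Proj n) (suc k)} → (∀ i → Silent (lookup Qs i)) → Silent (⨅ Qs)
  Silent-⨅ {Qs = _ ∷ []}    s = s zero
  Silent-⨅ {Qs = _ ∷ _ ∷ _} s = ⊓ s

  subᴾ-⨅ : ∀ {m n k} (σ : Fin m → Proj n) (Qs : Vec (Proj m) (suc k)) →
           subᴾ σ (⨅ Qs) ≡ ⨅ (subᴾᵛ σ Qs)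
  subᴾ-⨅ σ (_ ∷ [])    = refl
  subᴾ-⨅ σ (_ ∷ _ ∷ _) = refl

  if-does : ∀ {A B : Set} {x y : B} (d : Dec A) →
            (A × (if does d then x else y) ≡ x) ⊎ ((if does d then x else y) ≡ y)
  if-does (yes a) = inj₁ (a , refl)
  if-does (no _)  = inj₂ refl

  μ-↾ : ∀ {n} (G : Global (suc n)) r →
        (μ G ↾ r ≡ end × r ∉ pt G × Closed (μ G)) ⊎ (μ G ↾ r ≡ μ (G ↾ r))
  μ-↾ G r = case if-does (¬? (r ∈? pt G) ×-dec closed? (μ G)) of λ where
    (inj₁ ((r∉ , closed) , eq)) → inj₁ (eq , r∉ , closed)
    (inj₂ eq)                   → inj₂ eq

  ∈-tail : ∀ {n x} {p : Subset.Subset (suc n)} → suc x Subset.∈ p → x Subset.∈ tail p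
  ∈-tail (Vec.there x∈p) = x∈p

  Silent-μ↾ : ∀ {n m} (G : Global (suc n)) {r} {σ : Fin n → Proj m} →
              Silent (subᴾ (liftᴾ σ) (G ↾ r)) → Silent (subᴾ σ (μ G ↾ r))
  Silent-μ↾ G {r} s with μ-↾ G r
  ... | inj₁ (eq , _) rewrite eq = end
  ... | inj₂ eq       rewrite eq = μ s

  if-≢ : ∀ {A : Set} {x y : A} {p q : Loc} → p ≢ q → (if does (em {p ≡ q}) then x else y) ≡ y
  if-≢ {p = p} {q} p≢q with em {p ≡ q}
  ... | yes p≡q = ⊥-elim (p≢q p≡q)
  ... | no _    = refl

  if-≡ : ∀ {A : Set} {x y : A} {p q : Loc} → p ≡ q → (if does (em {p ≡ q}) then x else y) ≡ x
  if-≡ {p = p} {q} p≡q with em {p ≡ q}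
  ... | yes _  = refl
  ... | no p≢q = ⊥-elim (p≢q p≡q)

  -- The restriction to free variables matters in `unfold-⊢`: there `μ G` is closed although its
  -- scope may be nonempty, and nothing is known about the other entries of the environment.
  Silent-↾  : ∀ {n m} (G : Global n) {r} {σ : Fin n → Proj m} → r ∉ pt G →
              (∀ x → x Subset.∈ fv G → Silent (σ x)) → Silent (subᴾ σ (G ↾ r))
  Silent-↾ᵇ : ∀ {n m k} p (bs : Vec (Branch (Global n)) k) {r} {σ : Fin n → Proj m} →
              r ∉ ptᵇ p bs → (∀ x → x Subset.∈ fvᵇ bs → Silent (σ x)) →
              ∀ i → Silent (lookup (subᴾᵛ σ (projBranches p bs r)) i)
  Silent-↾ end r∉ sσ = end
  Silent-↾ (⊞ p bs@(_ ∷ _)) {r} {σ} r∉ sσ =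
    ≡.subst (Silent ∘ subᴾ σ) (≡.sym (if-≢ {p = r} λ { refl → r∉ (here refl) }))
      (≡.subst Silent (≡.sym (subᴾ-⨅ σ (projBranches p bs r)))
        (Silent-⨅ {Qs = subᴾᵛ σ (projBranches p bs r)} (Silent-↾ᵇ p bs r∉ sσ)))
  Silent-↾ (var x) r∉ sσ = sσ x (x∈⁅x⁆ x)
  Silent-↾ (μ G) r∉ sσ = Silent-μ↾ G (Silent-↾ G r∉ λ where
    zero    _ → var
    (suc x) m → Silent-renᴾ (sσ x (∈-tail m)))
  Silent-↾ᵇ p ((q · a ⟫ G) ∷ bs) {r} {σ} r∉ sσ zero =
    ≡.subst (Silent ∘ subᴾ σ) (≡.sym (if-≢ {p = r} λ { refl → r∉ (there (here refl)) }))
      (Silent-↾ G (λ r∈ → r∉ (there (there (∈-++⁺ˡ r∈)))) (λ x m → sσ x (x∈p∪q⁺ (inj₁ m))))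
  Silent-↾ᵇ p ((q · a ⟫ G) ∷ bs) r∉ sσ (suc i) =
    Silent-↾ᵇ p bs (λ r∈ → r∉ (there (there (∈-++⁺ʳ (pt G) r∈))))
      (λ x m → sσ x (x∈p∪q⁺ (inj₂ m))) i

  -- Heights of the exposed parts of projection types and threads

  -- Merges cost nothing, because passing to a branch is a structural step on the global type; only
  -- entering a recursion has to lower a number.
  height  : ∀ {n} → Proj n → ℕ
  heightᵛ : ∀ {n k} → Vec (Proj n) k → ℕ
  height end     = 0
  height (⊕ bs)  = 0
  height (¿ b)   = 0
  height (⊓ Qs)  = heightᵛ Qs
  height (var x) = 0
  height (μ Q)   = suc (height Q)
  heightᵛ []       = 0
  heightᵛ (Q ∷ Qs) = height Q ⊔ heightᵛ Qs

  height-lookup : ∀ {n k} (Qs : Vec (Proj n) k) i → height (lookup Qs i) ≤ heightᵛ Qs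
  height-lookup (Q ∷ Qs) zero    = ℕ.m≤m⊔n _ _
  height-lookup (Q ∷ Qs) (suc i) = ℕ.m≤n⇒m≤o⊔n (height Q) (height-lookup Qs i)

  height-⨅ : ∀ {n k} (Qs : Vec (Proj n) (suc k)) i → height (lookup Qs i) ≤ height (⨅ Qs)
  height-⨅ (Q ∷ [])       zero = ℕ.≤-refl
  height-⨅ Qs@(_ ∷ _ ∷ _) i    = height-lookup Qs i

  height-renᴾ  : ∀ {m n} (ρ : Fin m → Fin n) Q → height (renᴾ ρ Q) ≡ height Q
  height-renᴾᵛ : ∀ {m n k} (ρ : Fin m → Fin n) (Qs : Vec (Proj m) k) →
                 heightᵛ (renᴾᵛ ρ Qs) ≡ heightᵛ Qs
  height-renᴾ ρ end             = refl
  height-renᴾ ρ (⊕ bs)          = refl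
  height-renᴾ ρ (¿ (_ · _ ⟫ _)) = refl
  height-renᴾ ρ (⊓ Qs)          = height-renᴾᵛ ρ Qs
  height-renᴾ ρ (var x)         = refl
  height-renᴾ ρ (μ Q)           = ≡.cong suc (height-renᴾ (liftᵣ ρ) Q)
  height-renᴾᵛ ρ []       = refl
  height-renᴾᵛ ρ (Q ∷ Qs) = ≡.cong₂ _⊔_ (height-renᴾ ρ Q) (height-renᴾᵛ ρ Qs)

  -- A type substituted below a send or receive does not contribute to the height, so a guarded
  -- variable may be replaced by a type of any height.
  height-mono  : ∀ {l m n} {σ : Fin l → Proj m} {υ : Fin l → Proj n} Q →
                 (∀ x → ExposedIn x Q → height (σ x) ≤ height (υ x)) →
                 height (subᴾ σ Q) ≤ height (subᴾ υ Q)
  height-monoᵛ : ∀ {l m n k} {σ : Fin l → Proj m} {υ : Fin l → Proj n} (Qs : Vec (Proj l) k) →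
                 (∀ i x → ExposedIn x (lookup Qs i) → height (σ x) ≤ height (υ x)) →
                 heightᵛ (subᴾᵛ σ Qs) ≤ heightᵛ (subᴾᵛ υ Qs)
  height-mono end             le = z≤n
  height-mono (⊕ bs)          le = z≤n
  height-mono (¿ (_ · _ ⟫ _)) le = z≤n
  height-mono (⊓ Qs)          le = height-monoᵛ Qs (λ i x e → le x (⊓ i e))
  height-mono (var x)         le = le x var
  height-mono {σ = σ} {υ} (μ Q) le = s≤s (height-mono Q λ where
    zero    e → z≤n
    (suc x) e → ≡.subst₂ _≤_ (≡.sym (height-renᴾ suc (σ x))) (≡.sym (height-renᴾ suc (υ x)))
                  (le x (μ e)))
  height-monoᵛ []       le = z≤n
  height-monoᵛ (Q ∷ Qs) le = ℕ.⊔-mono-≤ (height-mono Q (le zero)) (height-monoᵛ Qs (le ∘ suc))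

  data Leads : ∀ {n} → Fin n → Thread n → Set where
    var : ∀ {n} {x : Fin n} → Leads x (var x)
    μ   : ∀ {n} {x : Fin n} {P} → Leads (suc x) P → Leads x (μ P)

  -- `WFᵀ` is not preserved by unfolding: a `μX.Y` inside a `μY` turns into a `μX.μY.P`. This weaker
  -- condition is preserved, and it still bounds the number of consecutive unfoldings.
  data Contractive {n : ℕ} : Thread n → Set where
    end : Contractive end
    ⊕   : ∀ {k} {bs : Vec (Branch (Thread n)) (suc k)} →
          (∀ i → Contractive (cont (lookup bs i))) → Contractive (⊕ bs)
    Σ?  : ∀ {k} {bs : Vec (Branch (Thread n)) k} →
          (∀ i → Contractive (cont (lookup bs i))) → Contractive (Σ? bs)
    var : ∀ {x} → Contractive (var x)
    μ   : ∀ {P} → ¬ Leads zero P → Contractive P → Contractive (μ P)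

  WFᵀ⇒Contractive : ∀ {n} {P : Thread n} → WFᵀ P → Contractive P
  WFᵀ⇒Contractive end    = end
  WFᵀ⇒Contractive (⊕ w)  = ⊕ (WFᵀ⇒Contractive ∘ w)
  WFᵀ⇒Contractive (Σ? w) = Σ? (WFᵀ⇒Contractive ∘ w)
  WFᵀ⇒Contractive var    = var
  WFᵀ⇒Contractive (μ P≢var P≢μ w) =
    μ (λ { var → P≢var refl ; (μ l) → P≢μ _ refl }) (WFᵀ⇒Contractive w)

  lookup-renᵇ : ∀ {m n k} (ρ : Fin m → Fin n) (bs : Vec (Branch (Thread m)) k) i →
                cont (lookup (renᵇ ρ bs) i) ≡ ren ρ (cont (lookup bs i))
  lookup-renᵇ ρ ((_ · _ ⟫ _) ∷ bs) zero    = refl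
  lookup-renᵇ ρ ((_ · _ ⟫ _) ∷ bs) (suc i) = lookup-renᵇ ρ bs i

  lookup-subᵇ : ∀ {m n k} (σ : Fin m → Thread n) (bs : Vec (Branch (Thread m)) k) i →
                cont (lookup (subᵇ σ bs) i) ≡ sub σ (cont (lookup bs i))
  lookup-subᵇ σ ((_ · _ ⟫ _) ∷ bs) zero    = refl
  lookup-subᵇ σ ((_ · _ ⟫ _) ∷ bs) (suc i) = lookup-subᵇ σ bs i

  Leads-ren⁻ : ∀ {m n} {ρ : Fin m → Fin n} {y} P → Leads y (ren ρ P) →
               ∃[ x ] Leads x P × y ≡ ρ x
  Leads-ren⁻ (var x) var   = x , var , refl
  Leads-ren⁻ (μ P)   (μ l) with Leads-ren⁻ P l
  ... | suc x , l′ , refl = x , μ l′ , refl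

  Leads-sub⁻ : ∀ {m n} {σ : Fin m → Thread n} {y} P → Leads y (sub σ P) →
               ∃[ x ] Leads x P × Leads y (σ x)
  Leads-sub⁻ (var x) l = x , var , l
  Leads-sub⁻ {σ = σ} (μ P) (μ l) with Leads-sub⁻ P l
  ... | suc x , l′ , l″ with Leads-ren⁻ (σ x) l″
  ...   | _ , l‴ , refl = x , μ l′ , l‴

  Contractive-ren : ∀ {m n} {ρ : Fin m → Fin n} {P} → Contractive P → Contractive (ren ρ P)
  Contractive-ren end   = end
  Contractive-ren {ρ = ρ} (⊕ {bs = bs} c) =
    ⊕ λ i → ≡.subst Contractive (≡.sym (lookup-renᵇ ρ bs i)) (Contractive-ren (c i))
  Contractive-ren {ρ = ρ} (Σ? {bs = bs} c) =
    Σ? λ i → ≡.subst Contractive (≡.sym (lookup-renᵇ ρ bs i)) (Contractive-ren (c i))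
  Contractive-ren var   = var
  Contractive-ren (μ {P} ¬l c) =
    μ (λ l → case Leads-ren⁻ P l of λ { (zero , l′ , _) → ¬l l′ }) (Contractive-ren c)

  Contractive-sub : ∀ {m n} {σ : Fin m → Thread n} {P} → Contractive P →
                    (∀ x → Contractive (σ x)) → Contractive (sub σ P)
  Contractive-sub end   cσ = end
  Contractive-sub {σ = σ} (⊕ {bs = bs} c) cσ =
    ⊕ λ i → ≡.subst Contractive (≡.sym (lookup-subᵇ σ bs i)) (Contractive-sub (c i) cσ)
  Contractive-sub {σ = σ} (Σ? {bs = bs} c) cσ =
    Σ? λ i → ≡.subst Contractive (≡.sym (lookup-subᵇ σ bs i)) (Contractive-sub (c i) cσ)
  Contractive-sub var   cσ = cσ _
  Contractive-sub {σ = σ} (μ {P} ¬l c) cσ =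
    μ (λ l → case Leads-sub⁻ P l of λ where
         (zero  , l′ , _)  → ¬l l′
         (suc x , _  , l″) → case Leads-ren⁻ (σ x) l″ of λ { (_ , _ , ()) })
      (Contractive-sub c λ { zero → var ; (suc x) → Contractive-ren (cσ x) })

  heightᵀ : ∀ {n} → Thread n → ℕ
  heightᵀ (μ P) = suc (heightᵀ P)
  heightᵀ _     = 0

  heightᵀ-ren : ∀ {m n} (ρ : Fin m → Fin n) P → heightᵀ (ren ρ P) ≡ heightᵀ P
  heightᵀ-ren ρ end     = refl
  heightᵀ-ren ρ (⊕ _)   = refl
  heightᵀ-ren ρ (Σ? _)  = refl
  heightᵀ-ren ρ (var _) = refl
  heightᵀ-ren ρ (μ P)   = ≡.cong suc (heightᵀ-ren (liftᵣ ρ) P)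

  heightᵀ-sub : ∀ {m n} {σ : Fin m → Thread n} P →
                (∀ x → Leads x P → heightᵀ (σ x) ≡ 0) → heightᵀ (sub σ P) ≡ heightᵀ P
  heightᵀ-sub end     eq = refl
  heightᵀ-sub (⊕ _)   eq = refl
  heightᵀ-sub (Σ? _)  eq = refl
  heightᵀ-sub (var x) eq = eq x var
  heightᵀ-sub {σ = σ} (μ P) eq = ≡.cong suc (heightᵀ-sub P λ where
    zero    _ → refl
    (suc x) l → ≡.trans (heightᵀ-ren suc (σ x)) (eq x (μ l)))

  -- The right-hand side is one less than `heightᵀ (μ P)`; this is the termination measure of
  -- `settle`.
  heightᵀ-unfold : ∀ {P : Thread 1} → Contractive (μ P) → heightᵀ (P [ μ P /0]) ≡ heightᵀ P
  heightᵀ-unfold {P} (μ ¬l _) = heightᵀ-sub P λ { zero l → ⊥-elim (¬l l) }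

  Contractiveˢ : ThreadState → Set
  Contractiveˢ (thread P)    = Contractive P
  Contractiveˢ (⟨ _ ! _ ⟩ P) = Contractive P

  τ-Contractive : ∀ {S S′} → τStep S S′ → Contractiveˢ S → Contractiveˢ S′
  τ-Contractive (choice i eq) (⊕ c) = ≡.subst Contractive (≡.cong cont eq) (c i)
  τ-Contractive unfold        (μ ¬l c) = Contractive-sub c λ { zero → μ ¬l c }

  -- Closures of global types

  -- A global type with closures for its free variables; this replaces unfolding
  -- by substitution in global types.
  data Closure : Set where
    clo : ∀ {n} → Global n → (Fin n → Closure) → Closure

  infix 6 _⇂_

  _⇂_ : Closure → Loc → Proj 0
  clo G env ⇂ r = subᴾ (λ x → env x ⇂ r) (G ↾ r)

  infixl 5 _▹_

  _▹_ : ∀ {n} → (Fin n → Closure) → Closure → Fin (suc n) → Closure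
  (env ▹ K) zero    = K
  (env ▹ K) (suc x) = env x

  -- Hereditary through the environment, since a variable is resolved by moving to its entry.
  -- Guardedness is recorded for the one location `p` whose liveness is at stake.
  data Admissible (p : Loc) (ps : List Loc) : Closure → Set where
    clo : ∀ {n} {G : Global n} {env} → WFᴳ G → Guarded (G ↾ p) → pt G ⊆ ps →
          (∀ x → Admissible p ps (env x)) → Admissible p ps (clo G env)

  -- If `μ G` projects to `end`, then its body projects to a silent type, and `⊢-Silent` applies.
  -- Otherwise this is one unfolding on the side of the type.
  unfold-⊢ : ∀ {n} (G : Global (suc n)) {env r S} →
             S ⊢ clo (μ G) env ⇂ r → S ⊢ clo G (env ▹ clo (μ G) env) ⇂ r
  unfold-⊢ G {env} {r} {S} t with μ-↾ G r
  ... | inj₁ (eq , r∉ , closed) = ⊢-Silent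
    (≡.subst (λ Q → S ⊢ subᴾ _ Q) eq t)
    (Silent-↾ G r∉ λ where
      zero    _ → ≡.subst (Silent ∘ subᴾ _) (≡.sym eq) end
      -- Since `μ G` is closed, only the bound variable can be free in `G`.
      (suc x) m → ⊥-elim (closed (x , ∈-tail m)))
  ... | inj₂ eq = ≡.subst (S ⊢_)
    (≡.trans
      (≡.cong (subᴾ (liftᴾ (λ x → env x ⇂ r)) (G ↾ r) [_/0]ᴾ)
        (≡.cong (subᴾ (λ x → env x ⇂ r)) (≡.sym eq)))
      (unfold-subᴾ {σ′ = λ x → (env ▹ clo (μ G) env) x ⇂ r} (λ _ → refl) (G ↾ r)))
    (⊢-μ (≡.subst (λ Q → S ⊢ subᴾ _ Q) eq t))

  -- The recursion itself is substituted for the bound variable, but that variable is not exposed,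
  -- so the only change in height is the loss of the outer `μ`.
  unfold-height : ∀ {n} (G : Global (suc n)) {env r} → μ G ↾ r ≡ μ (G ↾ r) →
                  ¬ ExposedIn zero (G ↾ r) →
                  height (clo G (env ▹ clo (μ G) env) ⇂ r) < height (clo (μ G) env ⇂ r)
  unfold-height G {env} {r} eq ¬e rewrite eq = s≤s (height-mono (G ↾ r) λ where
    zero    e → ⊥-elim (¬e e)
    (suc x) e → ℕ.≤-reflexive (≡.sym (height-renᴾ suc (env x ⇂ r))))

  lookup-projSends : ∀ {m n k} (σ : Fin m → Proj n) (bs : Vec (Branch (Global m)) k) r i →
                     lookup (subᴾᵇ σ (projSends bs r)) i ≡
                     (loc (lookup bs i) · label (lookup bs i) ⟫ subᴾ σ (cont (lookup bs i) ↾ r))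
  lookup-projSends σ ((_ · _ ⟫ _) ∷ bs) r zero    = refl
  lookup-projSends σ ((_ · _ ⟫ _) ∷ bs) r (suc i) = lookup-projSends σ bs r i

  lookup-projBranches : ∀ {m n k} (σ : Fin m → Proj n) p (bs : Vec (Branch (Global m)) k) r i →
                        lookup (subᴾᵛ σ (projBranches p bs r)) i ≡
                        subᴾ σ (if does (em {r ≡ loc (lookup bs i)})
                                then ¿ (p · label (lookup bs i) ⟫ (cont (lookup bs i) ↾ r))
                                else cont (lookup bs i) ↾ r)
  lookup-projBranches σ p ((_ · _ ⟫ _) ∷ bs) r zero    = refl
  lookup-projBranches σ p ((_ · _ ⟫ _) ∷ bs) r (suc i) = lookup-projBranches σ p bs r i

  module _ {n k : ℕ} {p : Loc} {bs : Vec (Branch (Global n)) (suc k)} {env : Fin n → Closure} where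

    ⇂-sender : clo (⊞ p bs) env ⇂ p ≡ ⊕ (subᴾᵇ (λ x → env x ⇂ p) (projSends bs p))
    ⇂-sender = ≡.cong (subᴾ _) (if-≡ {p = p} refl)

    ⇂-nonsender : ∀ {r} → r ≢ p →
                  clo (⊞ p bs) env ⇂ r ≡ ⨅ (subᴾᵛ (λ x → env x ⇂ r) (projBranches p bs r))
    ⇂-nonsender r≢p =
      ≡.trans (≡.cong (subᴾ _) (if-≢ r≢p)) (subᴾ-⨅ _ (projBranches p bs _))

    sender-⊢ : ∀ {q a P} → ⟨ q ! a ⟩ P ⊢ clo (⊞ p bs) env ⇂ p →
               ∃[ i ] loc (lookup bs i) ≡ q × label (lookup bs i) ≡ a ×
                      thread P ⊢ clo (cont (lookup bs i)) env ⇂ p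
    sender-⊢ {q} {a} {P} t with ≡.subst (⟨ q ! a ⟩ P ⊢_) ⇂-sender t
    ... | R , post , r with post r
    ... | sel i eq r′ with ≡.trans (≡.sym (lookup-projSends _ bs p i)) eq
    ... | refl = i , refl , refl , R , post , r′

    branch-⊢ : ∀ {r S} → r ≢ p → S ⊢ clo (⊞ p bs) env ⇂ r → ∀ i →
               S ⊢ subᴾ (λ x → env x ⇂ r)
                     (if does (em {r ≡ loc (lookup bs i)})
                      then ¿ (p · label (lookup bs i) ⟫ (cont (lookup bs i) ↾ r))
                      else cont (lookup bs i) ↾ r)
    branch-⊢ {r} {S} r≢p t i = ≡.subst (S ⊢_) (lookup-projBranches _ p bs r i)
      (⊢-⨅ (subᴾᵛ _ (projBranches p bs r)) (≡.subst (S ⊢_) (⇂-nonsender r≢p) t) i)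

    receiver-⊢ : ∀ {S} i → p ≢ loc (lookup bs i) →
                 let r = loc (lookup bs i) in
                 S ⊢ clo (⊞ p bs) env ⇂ r →
                 S ⊢ ¿ (p · label (lookup bs i) ⟫ (clo (cont (lookup bs i)) env ⇂ r))
    receiver-⊢ {S} i p≢r t = ≡.subst (λ Q → S ⊢ subᴾ _ Q) (if-≡ {p = loc (lookup bs i)} refl)
      (branch-⊢ (p≢r ∘ ≡.sym) t i)

    -- A merge types a thread by each of its parts at once, so a location outside of the
    -- communication fits every branch without moving.
    bystander-⊢ : ∀ {r S} i → r ≢ p → r ≢ loc (lookup bs i) →
                  S ⊢ clo (⊞ p bs) env ⇂ r → S ⊢ clo (cont (lookup bs i)) env ⇂ r
    bystander-⊢ {r} {S} i r≢p r≢q t =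
      ≡.subst (λ Q → S ⊢ subᴾ _ Q) (if-≢ r≢q) (branch-⊢ r≢p t i)

    bystander-height : ∀ {r} i → r ≢ p → r ≢ loc (lookup bs i) →
                       height (clo (cont (lookup bs i)) env ⇂ r) ≤ height (clo (⊞ p bs) env ⇂ r)
    bystander-height {r} i r≢p r≢q = ≡.subst₂ _≤_
      (≡.cong height (≡.trans (lookup-projBranches σ p bs r i) (≡.cong (subᴾ σ) (if-≢ r≢q))))
      (≡.cong height (≡.sym (⇂-nonsender r≢p)))
      (height-⨅ (subᴾᵛ σ (projBranches p bs r)) i)
      where
      σ : Fin n → Proj 0
      σ x = env x ⇂ r

  -- Guardedness and participants of branches

  Guarded-send : ∀ {n k} (bs : Vec (Branch (Global n)) k) {r} i →
                 Guarded (cont (lookup (projSends bs r) i)) → Guarded (cont (lookup bs i) ↾ r)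
  Guarded-send ((_ · _ ⟫ _) ∷ bs) zero    g = g
  Guarded-send ((_ · _ ⟫ _) ∷ bs) (suc i) g = Guarded-send bs i g

  Guarded-receive : ∀ {n k} p (bs : Vec (Branch (Global n)) k) {r} i →
                    Guarded (lookup (projBranches p bs r) i) → Guarded (cont (lookup bs i) ↾ r)
  Guarded-receive p ((q · _ ⟫ _) ∷ bs) {r} zero g with em {r ≡ q} | g
  ... | yes _ | ¿ g′ = g′
  ... | no _  | g′   = g′
  Guarded-receive p ((_ · _ ⟫ _) ∷ bs) (suc i) g = Guarded-receive p bs i g

  Guarded-⨅ : ∀ {n k} (Qs : Vec (Proj n) (suc k)) → Guarded (⨅ Qs) → ∀ i → Guarded (lookup Qs i)
  Guarded-⨅ (_ ∷ [])    g     zero = g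
  Guarded-⨅ (_ ∷ _ ∷ _) (⊓ g) i    = g i

  Guarded-branch : ∀ {n k} p (bs : Vec (Branch (Global n)) (suc k)) {r} →
                   Guarded (⊞ p bs ↾ r) → ∀ i → Guarded (cont (lookup bs i) ↾ r)
  Guarded-branch p bs {r} g i with em {r ≡ p} | g
  ... | yes _ | ⊕ g′ = Guarded-send bs i (g′ i)
  ... | no _  | g′   = Guarded-receive p bs i (Guarded-⨅ (projBranches p bs r) g′ i)

  pt-branch : ∀ {n k} p (bs : Vec (Branch (Global n)) k) i → pt (cont (lookup bs i)) ⊆ ptᵇ p bs
  pt-branch p ((_ · _ ⟫ _) ∷ bs) zero    r∈ = there (there (∈-++⁺ˡ r∈))
  pt-branch p ((_ · _ ⟫ G) ∷ bs) (suc i) r∈ = there (there (∈-++⁺ʳ (pt G) (pt-branch p bs i r∈)))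

  sender∈pt : ∀ {n k} p (bs : Vec (Branch (Global n)) (suc k)) → p ∈ ptᵇ p bs
  sender∈pt p ((_ · _ ⟫ _) ∷ bs) = here refl

  receiver∈pt : ∀ {n k} p (bs : Vec (Branch (Global n)) k) i → loc (lookup bs i) ∈ ptᵇ p bs
  receiver∈pt p ((_ · _ ⟫ _) ∷ bs) zero    = there (here refl)
  receiver∈pt p ((_ · _ ⟫ G) ∷ bs) (suc i) = there (there (∈-++⁺ʳ (pt G) (receiver∈pt p bs i)))

  Admissible-branch : ∀ {n k p ps s} {bs : Vec (Branch (Global n)) (suc k)} {env} →
                      Admissible p ps (clo (⊞ s bs) env) →
                      ∀ i → Admissible p ps (clo (cont (lookup bs i)) env)
  Admissible-branch {s = s} {bs} (clo (⊞ _ wf) g pt⊆ adm) i =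
    clo (wf i) (Guarded-branch s bs g i) (pt⊆ ∘ pt-branch s bs i) adm

  -- Networks as finite maps

  -- Structural congruence turns into pointwise equality here, and concurrent transitions can be
  -- commuted location by location.
  Config : Set
  Config = Loc → Maybe ThreadState

  find : List (Loc × ThreadState) → Config
  find []            r = nothing
  find ((p , S) ∷ l) r with em {r ≡ p}
  ... | yes _ = just S
  ... | no _  = find l r

  ⟦_⟧ᶜ : NetState → Config
  ⟦ N ⟧ᶜ = find (components N)

  find-here : ∀ {p S l} → find ((p , S) ∷ l) p ≡ just S
  find-here {p} with em {p ≡ p}
  ... | yes _  = refl
  ... | no p≢p = ⊥-elim (p≢p refl)

  find-there : ∀ {p S l r} → r ≢ p → find ((p , S) ∷ l) r ≡ find l r
  find-there {p} {r = r} r≢p with em {r ≡ p}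
  ... | yes r≡p = ⊥-elim (r≢p r≡p)
  ... | no _    = refl

  find⇒∈ : ∀ {l r S} → find l r ≡ just S → (r , S) ∈ l
  find⇒∈ {(p , _) ∷ l} {r} eq with em {r ≡ p} | eq
  ... | yes refl | refl = here refl
  ... | no _     | eq′  = there (find⇒∈ eq′)

  ∈⇒find : ∀ {l r S} → Unique (map proj₁ l) → (r , S) ∈ l → find l r ≡ just S
  ∈⇒find u       (here refl) = find-here
  ∈⇒find (d ∷ u) (there m)   =
    ≡.trans (find-there (All.lookup d (∈-map⁺ proj₁ m) ∘ ≡.sym)) (∈⇒find u m)

  ∈⇒find-just : ∀ {l r} → r ∈ map proj₁ l → ∃[ S ] find l r ≡ just S
  ∈⇒find-just {(p , S) ∷ l} {r} m with em {r ≡ p} | m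
  ... | yes _  | _         = S , refl
  ... | no r≢p | here r≡p  = ⊥-elim (r≢p r≡p)
  ... | no _   | there m′  = ∈⇒find-just m′

  find-↭ : ∀ {l l′} → Unique (map proj₁ l) → Unique (map proj₁ l′) → l ↭ l′ →
           ∀ r → find l r ≡ find l′ r
  find-↭ {l} {l′} u u′ l↭l′ r with find l r in eq | find l′ r in eq′
  ... | just S  | just S′ = ≡.trans (≡.sym (∈⇒find u′ (↭.∈-resp-↭ l↭l′ (find⇒∈ {l} eq)))) eq′
  ... | just S  | nothing = ≡.trans (≡.sym (∈⇒find u′ (↭.∈-resp-↭ l↭l′ (find⇒∈ {l} eq)))) eq′
  ... | nothing | just S′ =
    ≡.trans (≡.sym eq) (∈⇒find u (↭.∈-resp-↭ (↭-sym l↭l′) (find⇒∈ {l′} eq′)))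
  ... | nothing | nothing = refl

  ≅⇒↭ : ∀ {M N} → M ≅ N → components M ↭ components N
  ≅⇒↭ refl          = ↭-refl
  ≅⇒↭ (sym e)       = ↭-sym (≅⇒↭ e)
  ≅⇒↭ (trans e e′)  = ↭-trans (≅⇒↭ e) (≅⇒↭ e′)
  ≅⇒↭ (cong e e′)   = ↭.++⁺ (≅⇒↭ e) (≅⇒↭ e′)
  ≅⇒↭ (assoc {L} {M} {N}) = ↭.++-assoc (components L) (components M) (components N)
  ≅⇒↭ (comm {M} {N}) = ↭.++-comm (components M) (components N)
  ≅⇒↭ (identity {N}) = ↭.++-identityʳ (components N)

  Distinct : NetState → Set
  Distinct N = Unique (locs N)

  ≅-Distinct : ∀ {M N} → M ≅ N → Distinct M → Distinct N
  ≅-Distinct e = ↭ₛ.Unique-resp-↭ (≡.setoid Loc) (↭⇒↭ₛ (↭.map⁺ proj₁ (≅⇒↭ e)))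

  ≅-⟦⟧ : ∀ {M N} → Distinct M → M ≅ N → ∀ r → ⟦ M ⟧ᶜ r ≡ ⟦ N ⟧ᶜ r
  ≅-⟦⟧ u e = find-↭ u (≅-Distinct e u) (≅⇒↭ e)

  isolate : ∀ N {p S} → (p , S) ∈ components N → ∃[ N′ ] N ≅ p ⟦ S ⟧ ∥ N′
  isolate (p ⟦ S ⟧) (here refl) = 𝟘 , sym identity
  isolate (M ∥ N) m with ∈-++⁻ (components M) m
  ... | inj₁ m′ with isolate M m′
  ...   | M′ , e = M′ ∥ N , trans (cong e refl) assoc
  isolate (M ∥ N) m | inj₂ m′ with isolate N m′
  ...   | N′ , e = N′ ∥ M , trans comm (trans (cong e refl) assoc)

  proc : ∀ N {p S} → ⟦ N ⟧ᶜ p ≡ just S → Proc p N S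
  proc N eq = isolate N (find⇒∈ eq)

  isolate₂ : ∀ N {p q S T} → p ≢ q → ⟦ N ⟧ᶜ p ≡ just S → ⟦ N ⟧ᶜ q ≡ just T →
             ∃[ N′ ] N ≅ p ⟦ S ⟧ ∥ q ⟦ T ⟧ ∥ N′
  isolate₂ N p≢q eqp eqq with isolate N (find⇒∈ eqp)
  ... | N₁ , e with ↭.∈-resp-↭ (≅⇒↭ e) (find⇒∈ eqq)
  ...   | here refl = ⊥-elim (p≢q refl)
  ...   | there m with isolate N₁ m
  ...     | N₂ , e′ = N₂ , trans e (cong refl e′)

  data Fires (c d : Config) : Action → Set where
    τ    : ∀ {p S S′} → c p ≡ just S → τStep S S′ → d p ≡ just S′ → Fires c d (τ p)
    comm : ∀ {p a q Q k} {bs : Vec (Branch (Thread 0)) k} {P} (i : Fin k) →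
           c p ≡ just (⟨ q ! a ⟩ Q) → c q ≡ just (thread (Σ? bs)) →
           lookup bs i ≡ (p · a ⟫ P) →
           d p ≡ just (thread Q) → d q ≡ just (thread P) → Fires c d (comm p a q)

  Step : Config → Action → Config → Set
  Step c α d = Fires c d α × (∀ r → r ∉ comp α → c r ≡ d r)

  -- A transition neither reads nor writes outside of its components. Every reordering below rests
  -- on this.
  Step-transport : ∀ {c c′ d d′ α} → (∀ r → r ∈ comp α → c r ≡ c′ r) →
                   (∀ r → r ∈ comp α → d r ≡ d′ r) → (∀ r → r ∉ comp α → c′ r ≡ d′ r) →
                   Step c α d → Step c′ α d′
  Step-transport c≡ d≡ fr (τ cp t dp , _) =
    τ (≡.trans (≡.sym (c≡ _ (here refl))) cp) t (≡.trans (≡.sym (d≡ _ (here refl))) dp) , fr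
  Step-transport c≡ d≡ fr (comm i cp cq eq dp dq , _) =
    comm i (≡.trans (≡.sym (c≡ _ (here refl))) cp)
           (≡.trans (≡.sym (c≡ _ (there (here refl)))) cq) eq
           (≡.trans (≡.sym (d≡ _ (here refl))) dp)
           (≡.trans (≡.sym (d≡ _ (there (here refl)))) dq) , fr

  Step-resp : ∀ {c c′ d d′ α} → (∀ r → c r ≡ c′ r) → (∀ r → d r ≡ d′ r) →
              Step c α d → Step c′ α d′
  Step-resp c≡ d≡ s@(_ , fr) = Step-transport (λ r _ → c≡ r) (λ r _ → d≡ r)
    (λ r r∉ → ≡.trans (≡.sym (c≡ r)) (≡.trans (fr r r∉) (d≡ r))) s

  Fires-distinct : ∀ {c d p a q} → Fires c d (comm p a q) → p ≢ q
  Fires-distinct (comm _ cp cq _ _ _) refl =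
    case ≡.trans (≡.sym cp) cq of λ ()

  sound : ∀ {M N α} → Distinct M → M -[ α ]→ N → Step ⟦ M ⟧ᶜ α ⟦ N ⟧ᶜ × Distinct N
  sound u (choice {N = N} i eq) =
    (τ find-here (choice i eq) find-here ,
     λ r r∉ → ≡.trans (find-there (r∉ ∘ here)) (≡.sym (find-there (r∉ ∘ here)))) , u
  sound u (unfold {N = N}) =
    (τ find-here unfold find-here ,
     λ r r∉ → ≡.trans (find-there (r∉ ∘ here)) (≡.sym (find-there (r∉ ∘ here)))) , u
  sound u@((p≢q ∷ _) ∷ _) (comm {N = N} i eq) =
    (comm i find-here (≡.trans (find-there (p≢q ∘ ≡.sym)) find-here) eq
       find-here (≡.trans (find-there (p≢q ∘ ≡.sym)) find-here) ,
     λ r r∉ → ≡.trans (find-there (r∉ ∘ here)) (≡.trans (find-there (r∉ ∘ there ∘ here))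
       (≡.sym (≡.trans (find-there (r∉ ∘ here)) (find-there (r∉ ∘ there ∘ here)))))) , u
  sound u (struct e t e′) with sound (≅-Distinct e u) t
  ... | s , u′ =
    Step-resp (λ r → ≡.sym (≅-⟦⟧ u e r)) (≅-⟦⟧ u′ e′) s , ≅-Distinct e′ u′

  -- Race-freedom and justness are stated for transitions of networks, so a step of configurations
  -- has to be realised by one of these.
  complete : ∀ {N α d} → Distinct N → Step ⟦ N ⟧ᶜ α d →
             ∃[ N′ ] N -[ α ]→ N′ × (∀ r → ⟦ N′ ⟧ᶜ r ≡ d r)
  complete {N} {α} {d} u s@(f , fr) = N′ , t , agree
    where
    transition : ∀ {α} → Fires ⟦ N ⟧ᶜ d α →
                 ∃[ N′ ] N -[ α ]→ N′ × (∀ r → r ∈ comp α → ⟦ N′ ⟧ᶜ r ≡ d r)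
    transition (τ cp t dp) with proc N cp
    ... | M , e with t
    ...   | choice i eq = _ , struct e (choice i eq) refl ,
                          λ { r (here refl) → ≡.trans find-here (≡.sym dp) }
    ...   | unfold      = _ , struct e unfold refl ,
                          λ { r (here refl) → ≡.trans find-here (≡.sym dp) }
    transition f@(comm i cp cq eq dp dq) with isolate₂ N (Fires-distinct f) cp cq
    ... | M , e = _ , struct e (comm i eq) refl , λ where
      r (here refl)         → ≡.trans find-here (≡.sym dp)
      r (there (here refl)) → ≡.trans (≡.trans (find-there (Fires-distinct f ∘ ≡.sym)) find-here)
                                (≡.sym dq)
    N′ = proj₁ (transition f)
    t = proj₁ (proj₂ (transition f))
    agree : ∀ r → ⟦ N′ ⟧ᶜ r ≡ d r
    agree r with em {r ∈ comp α}
    ... | yes r∈ = proj₂ (proj₂ (transition f)) r r∈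
    -- Off the components, soundness of the transition just built gives the agreement.
    ... | no r∉  = ≡.trans (≡.sym (proj₂ (proj₁ (sound u t)) r r∉)) (fr r r∉)

  -- Reachability is defined on networks, so a representing network is carried along.
  RaceFreeᶜ : Config → Set
  RaceFreeᶜ c = ∃[ N ] Distinct N × RaceFree N × (∀ r → ⟦ N ⟧ᶜ r ≡ c r)

  RaceFreeᶜ-resp : ∀ {c d} → (∀ r → c r ≡ d r) → RaceFreeᶜ c → RaceFreeᶜ d
  RaceFreeᶜ-resp c≡d (N , u , rf , eq) = N , u , rf , λ r → ≡.trans (eq r) (c≡d r)

  RaceFreeᶜ-step : ∀ {c α d} → Step c α d → RaceFreeᶜ c → RaceFreeᶜ d
  RaceFreeᶜ-step s (N , u , rf , eq) with complete u (Step-resp (≡.sym ∘ eq) (λ _ → refl) s)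
  ... | N′ , t , eq′ = N′ , proj₂ (sound u t) , (λ M reach → rf M ((_ , t) ◅ reach)) , eq′

  -- The two conclusions answer the two disjuncts of a race. The second is needed because a thread
  -- may offer several receives with the same sender and label, while the typing speaks of only one
  -- of them.
  no-race : ∀ {c d e p q r a b} → RaceFreeᶜ c → Step c (comm p a r) d → Step c (comm q b r) e →
            p ≡ q × (∀ s → d s ≡ e s)
  no-race {d = d} {e} {p} {q} (N , u , rf , eq) s s′
    with complete u (Step-resp (≡.sym ∘ eq) (λ _ → refl) s)
       | complete u (Step-resp (≡.sym ∘ eq) (λ _ → refl) s′)
  ... | N′ , t , eq′ | N″ , t′ , eq″ = same-sender , same-result
    where
    same-sender : p ≡ q
    same-sender with em {p ≡ q}
    ... | yes p≡q = p≡q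
    ... | no p≢q  = ⊥-elim (rf N ε (_ , _ , _ , _ , _ , _ , _ , t , t′ , inj₁ p≢q))
    same-result : ∀ s → d s ≡ e s
    same-result s with em {N′ ≅ N″}
    ... | yes N′≅N″ = ≡.trans (≡.sym (eq′ s)) (≡.trans (≅-⟦⟧ (proj₂ (sound u t)) N′≅N″ s) (eq″ s))
    ... | no N′≇N″  = ⊥-elim (rf N ε (_ , _ , _ , _ , _ , _ , _ , t , t′ , inj₂ N′≇N″))

  -- Runs

  compᴹ : Maybe Action → List Loc
  compᴹ nothing  = []
  compᴹ (just α) = comp α

  Stepᴹ : Config → Maybe Action → Config → Set
  Stepᴹ c nothing  d = ∀ r → c r ≡ d r
  Stepᴹ c (just α) d = Step c α d

  Meets : Action → Maybe Action → Set
  Meets α a = ∃[ r ] r ∈ comp α × r ∈ compᴹ a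

  Stepᴹ-frame : ∀ a {c d} → Stepᴹ c a d → ∀ r → r ∉ compᴹ a → c r ≡ d r
  Stepᴹ-frame nothing  s       r _  = s r
  Stepᴹ-frame (just α) (_ , f) r r∉ = f r r∉

  Stepᴹ-transport : ∀ a {c c′ d d′} → (∀ r → r ∈ compᴹ a → c r ≡ c′ r) →
                    (∀ r → r ∈ compᴹ a → d r ≡ d′ r) → (∀ r → r ∉ compᴹ a → c′ r ≡ d′ r) →
                    Stepᴹ c a d → Stepᴹ c′ a d′
  Stepᴹ-transport nothing  _  _  fr _ r = fr r λ ()
  Stepᴹ-transport (just α) c≡ d≡ fr s   = Step-transport c≡ d≡ fr s

  -- The action nothing stands for an idle step, which pads finite paths and
  -- replaces transitions that have been moved to the front.
  record Run : Set where
    field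
      state  : ℕ → Config
      action : ℕ → Maybe Action
      step   : ∀ i → Stepᴹ (state i) (action i) (state (suc i))
      isJust : ∀ i {α d} → Step (state i) α d → ∃[ k ] i ≤ k × Meets α (action k)

  open Run

  stable : (st : ℕ → Config) (ac : ℕ → Maybe Action) →
           (∀ i → Stepᴹ (st i) (ac i) (st (suc i))) →
           ∀ {i j} r → i ≤ j → (∀ k → i ≤ k → k < j → r ∉ compᴹ (ac k)) → st i r ≡ st j r
  stable st ac sp {j = zero} r z≤n ∉ac = refl
  stable st ac sp {i} {suc j} r i≤ ∉ac with ℕ.m≤n⇒m<n∨m≡n i≤
  ... | inj₂ refl      = refl
  ... | inj₁ (s≤s i≤j) = ≡.trans
    (stable st ac sp r i≤j (λ k i≤k k<j → ∉ac k i≤k (ℕ.m≤n⇒m≤1+n k<j)))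
    (Stepᴹ-frame (ac j) (sp j) r (∉ac j i≤j ℕ.≤-refl))

  least : (P : ℕ → Set) → ∀ n → P n → ∃[ j ] P j × (∀ i → i < j → ¬ P i)
  least P n pn with em {P 0}
  ... | yes p0 = 0 , p0 , λ _ ()
  least P zero    p0 | no ¬p0 = ⊥-elim (¬p0 p0)
  least P (suc n) pn | no ¬p0 with least (P ∘ suc) n pn
  ... | j , pj , early = suc j , pj , λ { zero _ → ¬p0 ; (suc i) (s≤s i<j) → early i i<j }

  -- Justness yields a transition that meets `α`. Taking the first one leaves the components of `α`
  -- untouched until then; in both uses below `β` turns out to have the same components, so it can
  -- be advanced.
  first-meeting : ∀ ρ {α d} → Step (state ρ 0) α d →
                  ∃[ j ] ∃[ β ] action ρ j ≡ just β × Meets α (just β) ×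
                  (∀ i → i < j → ∀ r → r ∈ comp α → r ∉ compᴹ (action ρ i))
  first-meeting ρ {α} s with isJust ρ 0 s
  ... | k , _ , mk with least (Meets α ∘ action ρ) k mk
  ... | j , mj , early with action ρ j in eq | mj
  ... | just β  | mj′         = j , β , eq , mj′ , λ i i<j r r∈ r∈′ → early i i<j (r , r∈ , r∈′)
  ... | nothing | _ , _ , ()

  weight : Maybe Action → ℕ
  weight nothing  = 0
  weight (just _) = 1

  busy : (ℕ → Maybe Action) → ℕ → ℕ
  busy ac zero    = 0
  busy ac (suc m) = weight (ac m) + busy ac m

  busy-mono : ∀ {ac ac′} m → (∀ i → weight (ac i) ≤ weight (ac′ i)) → busy ac m ≤ busy ac′ m
  busy-mono zero    le = z≤n
  busy-mono (suc m) le = ℕ.+-mono-≤ (le m) (busy-mono m le)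

  busy-mono-< : ∀ {ac ac′ j} m → (∀ i → weight (ac i) ≤ weight (ac′ i)) →
                j < m → weight (ac j) < weight (ac′ j) → busy ac m < busy ac′ m
  busy-mono-< (suc m) le (s≤s j≤m) lt with ℕ.m≤n⇒m<n∨m≡n j≤m
  ... | inj₁ j<m  = ℕ.+-mono-≤-< (le m) (busy-mono-< m le j<m lt)
  ... | inj₂ refl = ℕ.+-mono-<-≤ lt (busy-mono m le)

  -- The transition β at position j is concurrent with all earlier ones, so it
  -- can be performed first, which leaves an idle step at position j.
  module Advance (ρ : Run) {j β} (at-j : action ρ j ≡ just β)
                 (early : ∀ i → i < j → ∀ r → r ∈ comp β → r ∉ compᴹ (action ρ i)) where

    -- The components of `β` show from the start the values they have after position `j`. The
    -- maximum with `suc j` achieves this and has no effect once `i` has passed `j`.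
    state′ : ℕ → Config
    state′ i r with em {r ∈ comp β}
    ... | yes _ = state ρ (i ⊔ suc j) r
    ... | no _  = state ρ i r

    action′ : ℕ → Maybe Action
    action′ i with em {i ≡ j}
    ... | yes _ = nothing
    ... | no _  = action ρ i

    moved : ∀ i {r} → r ∈ comp β → state′ i r ≡ state ρ (i ⊔ suc j) r
    moved i {r} r∈ with em {r ∈ comp β}
    ... | yes _ = refl
    ... | no r∉ = ⊥-elim (r∉ r∈)

    unmoved : ∀ i {r} → r ∉ comp β → state′ i r ≡ state ρ i r
    unmoved i {r} r∉ with em {r ∈ comp β}
    ... | yes r∈ = ⊥-elim (r∉ r∈)
    ... | no _   = refl

    before : ∀ i {r} → i ≤ suc j → r ∈ comp β → state′ i r ≡ state ρ (suc j) r
    before i {r} i≤ r∈ = ≡.trans (moved i r∈) (≡.cong (λ k → state ρ k r) (ℕ.m≤n⇒m⊔n≡n i≤))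

    after : ∀ i r → suc j ≤ i → state′ i r ≡ state ρ i r
    after i r j< with em {r ∈ comp β}
    ... | yes _ = ≡.cong (λ k → state ρ k r) (ℕ.m≥n⇒m⊔n≡m j<)
    ... | no _  = refl

    step-j : Step (state ρ j) β (state ρ (suc j))
    step-j = ≡.subst (λ a → Stepᴹ (state ρ j) a (state ρ (suc j))) at-j (step ρ j)

    unchanged : ∀ r → r ∈ comp β → state ρ 0 r ≡ state ρ j r
    unchanged r r∈ = stable (state ρ) (action ρ) (step ρ) r z≤n (λ k _ k<j → early k k<j r r∈)

    first-step : Step (state ρ 0) β (state′ 0)
    first-step = Step-transport
      (λ r r∈ → ≡.sym (unchanged r r∈)) (λ r r∈ → ≡.sym (moved 0 r∈))
      (λ r r∉ → ≡.sym (unmoved 0 r∉)) step-j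

    involved : ∀ i → i ≢ j → ∀ r → r ∈ compᴹ (action ρ i) →
               state ρ i r ≡ state′ i r × state ρ (suc i) r ≡ state′ (suc i) r
    involved i i≢j r r∈ with ℕ.<-cmp i j
    ... | tri< i<j _ _ = ≡.sym (unmoved i r∉) , ≡.sym (unmoved (suc i) r∉)
      where
      r∉ : r ∉ comp β
      r∉ r∈β = early i i<j r r∈β r∈
    ... | tri≈ _ i≡j _ = ⊥-elim (i≢j i≡j)
    ... | tri> _ _ j<i = ≡.sym (after i r j<i) , ≡.sym (after (suc i) r (ℕ.m≤n⇒m≤1+n j<i))

    uninvolved : ∀ i r → r ∉ compᴹ (action ρ i) → state′ i r ≡ state′ (suc i) r
    uninvolved i r r∉ with em {r ∈ comp β} | ℕ.<-≤-connex j i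
    ... | no r∉β | _        = Stepᴹ-frame (action ρ i) (step ρ i) r r∉
    ... | yes r∈ | inj₂ i≤j = ≡.cong (λ k → state ρ k r)
      (≡.trans (ℕ.m≤n⇒m⊔n≡n (ℕ.m≤n⇒m≤1+n i≤j)) (≡.sym (ℕ.m≤n⇒m⊔n≡n (s≤s i≤j))))
    ... | yes r∈ | inj₁ j<i = ≡.trans (≡.cong (λ k → state ρ k r) (ℕ.m≥n⇒m⊔n≡m j<i))
      (≡.trans (Stepᴹ-frame (action ρ i) (step ρ i) r r∉)
        (≡.sym (≡.cong (λ k → state ρ k r) (ℕ.m≥n⇒m⊔n≡m (ℕ.m≤n⇒m≤1+n j<i)))))

    idle : ∀ r → state′ j r ≡ state′ (suc j) r
    idle r with em {r ∈ comp β}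
    ... | yes r∈ = ≡.cong (λ k → state ρ k r)
      (≡.trans (ℕ.m≤n⇒m⊔n≡n (ℕ.n≤1+n j)) (≡.sym (ℕ.⊔-idem (suc j))))
    ... | no r∉  = proj₂ step-j r r∉

    step′ : ∀ i → Stepᴹ (state′ i) (action′ i) (state′ (suc i))
    step′ i with em {i ≡ j}
    ... | yes refl = idle
    ... | no i≢j   = Stepᴹ-transport (action ρ i)
      (λ r r∈ → proj₁ (involved i i≢j r r∈)) (λ r r∈ → proj₂ (involved i i≢j r r∈))
      (uninvolved i) (step ρ i)

    action′-≢ : ∀ i → i ≢ j → action′ i ≡ action ρ i
    action′-≢ i i≢j with em {i ≡ j}
    ... | yes i≡j = ⊥-elim (i≢j i≡j)
    ... | no _    = refl

    just-after : ∀ i {α d} → suc j ≤ i → Step (state′ i) α d → ∃[ k ] i ≤ k × Meets α (action′ k)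
    just-after i {α} j<i s with isJust ρ i (Step-resp (λ r → after i r j<i) (λ _ → refl) s)
    ... | k , i≤k , mk = k , i≤k ,
      ≡.subst (Meets α) (≡.sym (action′-≢ k λ { refl → ℕ.<⇒≱ j<i i≤k })) mk

    -- For `i ≤ j` the state at `i` need not occur in `ρ`, so justness of `ρ` does not apply there.
    -- But if nothing met `α` from `i` on, then `α` would still be enabled at `suc j`, where both
    -- runs agree.
    isJust′ : ∀ i {α d} → Step (state′ i) α d → ∃[ k ] i ≤ k × Meets α (action′ k)
    isJust′ i {α} {d} s with ℕ.<-≤-connex j i
    ... | inj₁ j<i = just-after i j<i s
    ... | inj₂ i≤j with em {∃[ k ] i ≤ k × Meets α (action′ k)}
    ...   | yes met = met
    ...   | no ¬met with just-after (suc j) ℕ.≤-refl delayed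
      where
      -- The target of the delayed `α`: as `d` on its components, as the later state elsewhere.
      d′ : Config
      d′ r with em {r ∈ comp α}
      ... | yes _ = d r
      ... | no _  = state′ (suc j) r
      d′-∈ : ∀ r → r ∈ comp α → d r ≡ d′ r
      d′-∈ r r∈ with em {r ∈ comp α}
      ... | yes _ = refl
      ... | no r∉ = ⊥-elim (r∉ r∈)
      d′-∉ : ∀ r → r ∉ comp α → state′ (suc j) r ≡ d′ r
      d′-∉ r r∉ with em {r ∈ comp α}
      ... | yes r∈ = ⊥-elim (r∉ r∈)
      ... | no _   = refl
      delayed : Step (state′ (suc j)) α d′
      delayed = Step-transport
        (λ r r∈ → stable state′ action′ step′ r (ℕ.m≤n⇒m≤1+n i≤j)
          (λ k i≤k _ r∈′ → ¬met (k , i≤k , r , r∈ , r∈′)))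
        d′-∈ d′-∉ s
    ...     | k , j<k , mk = k , ℕ.≤-trans (ℕ.m≤n⇒m≤1+n i≤j) j<k , mk

    run : Run
    run = record { state = state′ ; action = action′ ; step = step′ ; isJust = isJust′ }

    ∈-action′ : ∀ i {r} → r ∈ compᴹ (action′ i) → r ∈ compᴹ (action ρ i)
    ∈-action′ i r∈ with em {i ≡ j} | r∈
    ... | yes _ | ()
    ... | no _  | r∈′ = r∈′

    -- A whole state of the new run need not occur in `ρ`, but the state of each single location
    -- does, and this suffices to carry back the termination of `p`.
    origin : ∀ i r → ∃[ k ] state ρ k r ≡ state′ i r
    origin i r with em {r ∈ comp β}
    ... | yes _ = _ , refl
    ... | no _  = _ , refl

    weight-≤ : ∀ i → weight (action′ i) ≤ weight (action ρ i)
    weight-≤ i with em {i ≡ j}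
    ... | yes _ = z≤n
    ... | no _  = ℕ.≤-refl

    weight-< : weight (action′ j) < weight (action ρ j)
    weight-< with em {j ≡ j}
    ... | yes _  = ≡.subst (λ a → 0 < weight a) (≡.sym at-j) ℕ.≤-refl
    ... | no j≢j = ⊥-elim (j≢j refl)

    busy-≤ : ∀ m → busy action′ m ≤ busy (action ρ) m
    busy-≤ m = busy-mono m weight-≤

    busy-< : ∀ m → j < m → busy action′ m < busy (action ρ) m
    busy-< m j<m = busy-mono-< m weight-≤ j<m weight-<

  RaceFreeᶜ-state : ∀ ρ → RaceFreeᶜ (state ρ 0) → ∀ i → RaceFreeᶜ (state ρ i)
  RaceFreeᶜ-state ρ rf zero = rf
  RaceFreeᶜ-state ρ rf (suc i) with action ρ i | step ρ i
  ... | nothing | s = RaceFreeᶜ-resp s (RaceFreeᶜ-state ρ rf i)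
  ... | just _  | s = RaceFreeᶜ-step s (RaceFreeᶜ-state ρ rf i)

  -- Enabled transitions and the transitions that meet them

  _[_↦_] : Config → Loc → ThreadState → Config
  (c [ p ↦ S ]) r with em {r ≡ p}
  ... | yes _ = just S
  ... | no _  = c r

  update-≡ : ∀ {c p S} → (c [ p ↦ S ]) p ≡ just S
  update-≡ {p = p} with em {p ≡ p}
  ... | yes _  = refl
  ... | no p≢p = ⊥-elim (p≢p refl)

  update-≢ : ∀ {c p S r} → r ≢ p → (c [ p ↦ S ]) r ≡ c r
  update-≢ {p = p} {r = r} r≢p with em {r ≡ p}
  ... | yes r≡p = ⊥-elim (r≢p r≡p)
  ... | no _    = refl

  τ-enabled : ∀ {c r S T} → c r ≡ just S → τStep S T → Step c (τ r) (c [ r ↦ T ])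
  τ-enabled cr t = τ cr t update-≡ , λ s s∉ → ≡.sym (update-≢ (s∉ ∘ here))

  comm-enabled : ∀ {c s q a P k} {bs : Vec (Branch (Thread 0)) k} {T} i →
                 c s ≡ just (⟨ q ! a ⟩ P) → c q ≡ just (thread (Σ? bs)) →
                 lookup bs i ≡ (s · a ⟫ T) →
                 Step c (comm s a q) (c [ s ↦ thread P ] [ q ↦ thread T ])
  comm-enabled {c} {s} {q} i cs cq eq =
    comm i cs cq eq (≡.trans (update-≢ s≢q) update-≡) update-≡ ,
    λ r r∉ → ≡.sym (≡.trans (update-≢ (r∉ ∘ there ∘ here)) (update-≢ (r∉ ∘ here)))
    where
    s≢q : s ≢ q
    s≢q refl = case ≡.trans (≡.sym cs) cq of λ ()

  -- A thread that can take a τ-step is neither a selected output nor an input, so no communication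
  -- involves it. `T′` may differ from `T`, as a choice may be resolved in another way.
  τ-determined : ∀ {c d β r S T} → Fires c d β → r ∈ comp β → c r ≡ just S → τStep S T →
                 ∃[ T′ ] β ≡ τ r × τStep S T′ × d r ≡ just T′
  τ-determined (τ cp t′ dp) (here refl) cr t with ≡.trans (≡.sym cp) cr
  ... | refl = _ , refl , t′ , dp
  τ-determined (comm i cp cq eq dp dq) (here refl) cr t with ≡.trans (≡.sym cp) cr
  τ-determined (comm i cp cq eq dp dq) (here refl) cr () | refl
  τ-determined (comm i cp cq eq dp dq) (there (here refl)) cr t with ≡.trans (≡.sym cq) cr
  τ-determined (comm i cp cq eq dp dq) (there (here refl)) cr () | refl

  -- The state of `s` allows only its output to `q`, and that of `q` only a receive. The sender
  -- stays open here; a competitor of `s` is excluded by race-freedom in `advance-comm`.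
  comm-receiver : ∀ {c d β s q a P k} {bs : Vec (Branch (Thread 0)) k} → Fires c d β →
                  c s ≡ just (⟨ q ! a ⟩ P) → c q ≡ just (thread (Σ? bs)) →
                  Meets (comm s a q) (just β) → ∃[ s′ ] ∃[ b ] β ≡ comm s′ b q
  comm-receiver (τ cp t dp) cs cq (_ , here refl , here refl) with ≡.trans (≡.sym cp) cs
  comm-receiver (τ cp () dp) cs cq (_ , here refl , here refl) | refl
  comm-receiver (τ cp t dp) cs cq (_ , there (here refl) , here refl) with ≡.trans (≡.sym cp) cq
  comm-receiver (τ cp () dp) cs cq (_ , there (here refl) , here refl) | refl
  comm-receiver (comm _ cp _ _ _ _) cs cq (_ , here refl , here refl) with ≡.trans (≡.sym cp) cs
  ... | refl = _ , _ , refl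
  comm-receiver (comm _ _ cp _ _ _) cs cq (_ , here refl , there (here refl))
    with ≡.trans (≡.sym cp) cs
  ... | ()
  comm-receiver (comm _ cp _ _ _ _) cs cq (_ , there (here refl) , here refl)
    with ≡.trans (≡.sym cp) cq
  ... | ()
  comm-receiver (comm _ _ _ _ _ _) cs cq (_ , there (here refl) , there (here refl)) =
    _ , _ , refl

  comm-label : ∀ {c d s q a b P} → Fires c d (comm s b q) → c s ≡ just (⟨ q ! a ⟩ P) → b ≡ a
  comm-label (comm _ cp _ _ _ _) cs with ≡.trans (≡.sym cp) cs
  ... | refl = refl

  Step-Contractive : ∀ {c α d} → Step c α d →
                     (∀ r {S} → c r ≡ just S → Contractiveˢ S) →
                     (∀ r {S} → d r ≡ just S → Contractiveˢ S)
  Step-Contractive {α = α} (f , fr) con r dr with em {r ∈ comp α}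
  ... | no r∉  = con r (≡.trans (fr r r∉) dr)
  ... | yes r∈ with f | r∈
  ...   | τ cp t dp | here refl with ≡.trans (≡.sym dp) dr
  ...     | refl = τ-Contractive t (con r cp)
  Step-Contractive _ con r dr | yes _ | comm _ cp _ _ dp _ | here refl
    with ≡.trans (≡.sym dp) dr
  ... | refl = con r cp
  Step-Contractive _ con r dr | yes _ | comm i _ cq eq _ dq | there (here refl)
    with ≡.trans (≡.sym dq) dr | con r cq
  ... | refl | Σ? con′ = ≡.subst Contractive (≡.cong cont eq) (con′ i)

  Step-present : ∀ {c α d} → Step c α d → ∀ r → ∃[ S ] c r ≡ just S → ∃[ S ] d r ≡ just S
  Step-present {α = α} (f , fr) r (S , cr) with em {r ∈ comp α}
  ... | no r∉  = S , ≡.trans (≡.sym (fr r r∉)) cr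
  ... | yes r∈ with f | r∈
  ...   | τ _ _ dp           | here refl         = _ , dp
  ...   | comm _ _ _ _ dp _  | here refl         = _ , dp
  ...   | comm _ _ _ _ _ dq  | there (here refl) = _ , dq

  -- Liveness of p from position m on

  -- The bound `m` applies to transitions, whose positions survive the moves; a state `end` may be
  -- found at any position, and moves can shift it.
  Live : Loc → ℕ → Run → Set
  Live p m ρ = (∃[ i ] m ≤ i × p ∈ compᴹ (action ρ i)) ⊎ (∃[ i ] state ρ i p ≡ just (thread end))

  Live-advance : ∀ {p m} ρ {j β} (at-j : action ρ j ≡ just β) early →
                 Live p m (Advance.run ρ at-j early) → Live p m ρ
  Live-advance ρ at-j early (inj₁ (i , m≤i , p∈)) =
    inj₁ (i , m≤i , Advance.∈-action′ ρ at-j early i p∈)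
  Live-advance {p} ρ at-j early (inj₂ (i , eq)) with Advance.origin ρ at-j early i p
  ... | k , eq′ = inj₂ (k , ≡.trans eq′ eq)

  record Typed (ps : List Loc) (c : Config) (K : Closure) : Set₁ where
    field
      raceFree    : RaceFreeᶜ c
      contractive : ∀ r {S} → c r ≡ just S → Contractiveˢ S
      present     : ∀ r → r ∈ ps → ∃[ S ] c r ≡ just S
      typed       : ∀ r {S} → c r ≡ just S → S ⊢ K ⇂ r

  open Typed

  Typed-step : ∀ {ps c α d K K′} → Step c α d → Typed ps c K →
               (∀ r {S} → d r ≡ just S → S ⊢ K′ ⇂ r) → Typed ps d K′
  Typed-step s T t = record
    { raceFree    = RaceFreeᶜ-step s (raceFree T)
    ; contractive = Step-Contractive s (contractive T)
    ; present     = λ r r∈ → Step-present s r (present T r r∈)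
    ; typed       = t
    }

  module _ (p : Loc) (m : ℕ) (ps : List Loc) (p∈ps : p ∈ ps) where

    -- `earlier` is the induction hypothesis for fewer transitions before `m`; it sets no bound on
    -- the height.
    module Bounded (b : ℕ) (earlier : ∀ ρ K → Admissible p ps K → Typed ps (state ρ 0) K →
                                      busy (action ρ) m < b → Live p m ρ) where

      -- The continuation is called only if `β` comes from position `m` or later and does not
      -- involve `p`. From before `m`, `earlier` applies; from `m` on with `p` involved, `β` itself
      -- is the transition sought.
      advance : ∀ ρ {j β K′} (at-j : action ρ j ≡ just β) early → Admissible p ps K′ →
                Typed ps (Advance.state′ ρ at-j early 0) K′ → busy (action ρ) m ≤ b →
                (p ∉ comp β → busy (Advance.action′ ρ at-j early) m ≤ b →
                 Live p m (Advance.run ρ at-j early)) →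
                Live p m ρ
      advance ρ {j} {β} at-j early adm ty busy≤ k =
        case (ℕ.<-≤-connex j m , em {p ∈ comp β}) of λ where
          (inj₁ j<m , _)      → Live-advance ρ at-j early
            (earlier (Advance.run ρ at-j early) _ adm ty
              (ℕ.<-≤-trans (Advance.busy-< ρ at-j early m j<m) busy≤))
          (inj₂ m≤j , yes p∈) → inj₁ (j , m≤j , ≡.subst (λ a → p ∈ compᴹ a) (≡.sym at-j) p∈)
          (inj₂ m≤j , no p∉)  → Live-advance ρ at-j early
            (k p∉ (ℕ.≤-trans (Advance.busy-≤ ρ at-j early m) busy≤))

      -- The type `K` stays the same, by `τ-⊢` at `r` and by the frame elsewhere. `T` merely shows
      -- that `r` can move; the continuation must accept the `T′` that the run takes.
      advance-τ : ∀ ρ {K r S T} → state ρ 0 r ≡ just S → τStep S T →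
                  Admissible p ps K → Typed ps (state ρ 0) K → busy (action ρ) m ≤ b →
                  (∀ ρ′ T′ → τStep S T′ → state ρ′ 0 r ≡ just T′ →
                   (∀ s → s ≢ r → state ρ 0 s ≡ state ρ′ 0 s) →
                   Typed ps (state ρ′ 0) K → busy (action ρ′) m ≤ b → Live p m ρ′) →
                  Live p m ρ
      advance-τ ρ {K} {r} at-r t adm ty busy≤ k with first-meeting ρ (τ-enabled at-r t)
      ... | j , β , at-j , (_ , here refl , r∈) , early₀
        with τ-determined
               (proj₁ (≡.subst (λ a → Stepᴹ (state ρ j) a (state ρ (suc j))) at-j (step ρ j))) r∈
               (≡.trans (≡.sym (stable (state ρ) (action ρ) (step ρ) r z≤n
                 (λ i _ i<j → early₀ i i<j r (here refl)))) at-r) t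
      ...   | T′ , refl , t′ , at-r′ = advance ρ at-j early₀ adm ty′ busy≤
        λ _ → k run T′ t′ moved-r (λ s s≢r → ≡.sym (unmoved 0 λ { (here s≡r) → s≢r s≡r })) ty′
        where
        open Advance ρ at-j early₀
        moved-r : state′ 0 r ≡ just T′
        moved-r = ≡.trans (moved 0 (here refl)) at-r′
        ty′ : Typed ps (state′ 0) K
        ty′ = Typed-step first-step ty λ s {S} at-s → case em {s ≡ r} of λ where
          (yes refl) → ≡.subst (_⊢ K ⇂ r) (just-injective (≡.trans (≡.sym moved-r) at-s))
                         (τ-⊢ t′ (typed ty r at-r))
          (no s≢r) → typed ty s (≡.trans (≡.sym (unmoved 0 λ { (here s≡r) → s≢r s≡r })) at-s)

      -- The continuation learns that other locations are unchanged: in `claim-⊞` the output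
      -- selected by the sender has to survive while the receiver unfolds.
      settle : ∀ n ρ {K r} P → heightᵀ P ≤ n → state ρ 0 r ≡ just (thread P) →
               Admissible p ps K → Typed ps (state ρ 0) K → busy (action ρ) m ≤ b →
               (∀ ρ′ P′ → NotMu P′ → state ρ′ 0 r ≡ just (thread P′) →
                (∀ s → s ≢ r → state ρ 0 s ≡ state ρ′ 0 s) →
                Typed ps (state ρ′ 0) K → busy (action ρ′) m ≤ b → Live p m ρ′) →
               Live p m ρ
      settle n ρ end     _ at-r adm ty busy≤ k = k ρ _ (λ _ ()) at-r (λ _ _ → refl) ty busy≤
      settle n ρ (⊕ _)   _ at-r adm ty busy≤ k = k ρ _ (λ _ ()) at-r (λ _ _ → refl) ty busy≤
      settle n ρ (Σ? _)  _ at-r adm ty busy≤ k = k ρ _ (λ _ ()) at-r (λ _ _ → refl) ty busy≤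
      settle (suc n) ρ {r = r} (μ P) (s≤s h≤n) at-r adm ty busy≤ k =
        advance-τ ρ at-r unfold adm ty busy≤ λ where
          ρ′ _ unfold at-r′ same ty′ busy≤′ →
            settle n ρ′ (P [ μ P /0])
              (ℕ.≤-trans (ℕ.≤-reflexive (heightᵀ-unfold (contractive ty r at-r))) h≤n)
              at-r′ adm ty′ busy≤′
              λ ρ″ P′ ¬μ at-r″ same′ →
                k ρ″ P′ ¬μ at-r″ (λ s s≢r → ≡.trans (same s s≢r) (same′ s s≢r))

      -- The run may seem to let `q` receive from another sender or by another branch. But that
      -- transition and the expected one are enabled in the same state, so race-freedom equates
      -- senders and results; the label is fixed by the output that `s` has selected.
      advance-comm : ∀ ρ {K K′ s q a P k T} {bs : Vec (Branch (Thread 0)) k} i →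
                     state ρ 0 s ≡ just (⟨ q ! a ⟩ P) → state ρ 0 q ≡ just (thread (Σ? bs)) →
                     lookup bs i ≡ (s · a ⟫ T) →
                     thread P ⊢ K′ ⇂ s → thread T ⊢ K′ ⇂ q →
                     (∀ r {S} → r ≢ s → r ≢ q → S ⊢ K ⇂ r → S ⊢ K′ ⇂ r) →
                     Admissible p ps K′ → Typed ps (state ρ 0) K → busy (action ρ) m ≤ b →
                     (p ≢ s → p ≢ q → ∀ ρ′ → Typed ps (state ρ′ 0) K′ →
                      busy (action ρ′) m ≤ b → Live p m ρ′) →
                     Live p m ρ
      advance-comm ρ {K} {K′} {s} {q} {a} {P} {T = T} i at-s at-q eq P⊢ T⊢ others⊢ adm ty busy≤ k
        with first-meeting ρ (comm-enabled i at-s at-q eq)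
      ... | j , β , at-j , meets , early = conclude sender same-label
        where
        still : ∀ {r} → r ∈ s ∷ q ∷ [] → state ρ j r ≡ state ρ 0 r
        still {r} r∈ = ≡.sym (stable (state ρ) (action ρ) (step ρ) r z≤n
                         (λ i _ i<j → early i i<j r r∈))
        at-s′ : state ρ j s ≡ just (⟨ q ! a ⟩ P)
        at-s′ = ≡.trans (still (here refl)) at-s
        at-q′ : state ρ j q ≡ _
        at-q′ = ≡.trans (still (there (here refl))) at-q
        step-j : Step (state ρ j) β (state ρ (suc j))
        step-j = ≡.subst (λ a → Stepᴹ (state ρ j) a (state ρ (suc j))) at-j (step ρ j)
        receiver : ∃[ s′ ] ∃[ b ] β ≡ comm s′ b q
        receiver = comm-receiver (proj₁ step-j) at-s′ at-q′ meets
        step-j′ : Step (state ρ j) (comm (proj₁ receiver) (proj₁ (proj₂ receiver)) q)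
                       (state ρ (suc j))
        step-j′ = ≡.subst (λ β → Step (state ρ j) β (state ρ (suc j)))
                    (proj₂ (proj₂ receiver)) step-j
        expected : Step (state ρ j) (comm s a q) _
        expected = comm-enabled i at-s′ at-q′ eq
        unique = no-race (RaceFreeᶜ-state ρ (raceFree ty) j) expected step-j′
        sender : s ≡ proj₁ receiver
        sender = proj₁ unique
        same-label : proj₁ (proj₂ receiver) ≡ a
        same-label = comm-label
          (≡.subst (λ s → Fires _ _ (comm s (proj₁ (proj₂ receiver)) q)) (≡.sym sender)
            (proj₁ step-j′))
          at-s′
        conclude : s ≡ proj₁ receiver → proj₁ (proj₂ receiver) ≡ a → Live p m ρ
        conclude s≡ a≡ = advance ρ at-j′ early adm ty′ busy≤
          λ p∉ → k (p∉ ∘ here) (p∉ ∘ there ∘ here) run ty′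
          where
          at-j′ : action ρ j ≡ just (comm s a q)
          at-j′ = ≡.trans at-j (≡.cong just
            (≡.trans (proj₂ (proj₂ receiver)) (≡.cong₂ (λ s a → comm s a q) (≡.sym s≡) a≡)))
          open Advance ρ at-j′ early using (state′; run; first-step; moved; unmoved)
          s≢q : s ≢ q
          s≢q refl = case ≡.trans (≡.sym at-s) at-q of λ ()
          after-s : state′ 0 s ≡ just (thread P)
          after-s = ≡.trans (moved 0 (here refl)) (≡.trans (≡.sym (proj₂ unique s))
                      (≡.trans (update-≢ s≢q) update-≡))
          after-q : state′ 0 q ≡ just (thread T)
          after-q = ≡.trans (moved 0 (there (here refl)))
                      (≡.trans (≡.sym (proj₂ unique q)) update-≡)
          ty′ : Typed ps (state′ 0) K′
          ty′ = Typed-step first-step ty λ r {S} at-r → case (em {r ≡ s} , em {r ≡ q}) of λ where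
            (yes refl , _) → ≡.subst (_⊢ K′ ⇂ s) (just-injective (≡.trans (≡.sym after-s) at-r)) P⊢
            (no _ , yes refl) →
              ≡.subst (_⊢ K′ ⇂ q) (just-injective (≡.trans (≡.sym after-q) at-r)) T⊢
            (no r≢s , no r≢q) → others⊢ r r≢s r≢q (typed ty r
              (≡.trans
                (≡.sym (unmoved 0 λ { (here r≡s) → r≢s r≡s ; (there (here r≡q)) → r≢q r≡q }))
                at-r))

      -- The bound `h` can stay fixed during the structural induction, because the height does not
      -- grow when `p` is a bystander.
      Claim : ℕ → Closure → Set₁
      Claim h K = ∀ ρ → Admissible p ps K → Typed ps (state ρ 0) K → busy (action ρ) m ≤ b →
                  height (K ⇂ p) ≤ h → Live p m ρ

      -- Stated for the projection because a recursion in which `p` does not occur may also project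
      -- to `end`.
      claim-end : ∀ {h K} → K ⇂ p ≡ end → Claim h K
      claim-end {K = K} eq ρ adm ty busy≤ _ with present ty p p∈ps
      ... | thread P , at-p = settle (heightᵀ P) ρ P ℕ.≤-refl at-p adm ty busy≤
        λ ρ′ P′ ¬μ at-p′ _ ty′ _ → inj₂ (0 , ≡.trans at-p′ (≡.cong (just ∘ thread)
          (⊢-end ¬μ (≡.subst (thread P′ ⊢_) eq (typed ty′ p at-p′)))))
      ... | ⟨ q ! a ⟩ P , at-p with ≡.subst (⟨ q ! a ⟩ P ⊢_) eq (typed ty p at-p)
      ...   | R , post , r with post r
      ...     | ()

      claim-⊞ : ∀ {h n k s} {bs : Vec (Branch (Global n)) (suc k)} {env} →
                (∀ i → Claim h (clo (cont (lookup bs i)) env)) → Claim h (clo (⊞ s bs) env)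
      claim-⊞ {s = s} {bs} {env} rec ρ₀ adm@(clo (⊞ s≢ _) _ pt⊆ _) ty₀ busy≤₀ height≤ =
        send (proj₂ (present ty₀ s (pt⊆ (sender∈pt s bs))))
        where
        K : Closure
        K = clo (⊞ s bs) env
        receive : ∀ ρ {q a P} → state ρ 0 s ≡ just (⟨ q ! a ⟩ P) →
                  Typed ps (state ρ 0) K → busy (action ρ) m ≤ b → Live p m ρ
        receive ρ {P = P} at-s ty busy≤ with sender-⊢ {bs = bs} {env} (typed ty s at-s)
        ... | i , refl , refl , P⊢ = go (proj₂ (present ty r (pt⊆ (receiver∈pt s bs i))))
          where
          r : Loc
          r = loc (lookup bs i)
          go : ∀ {S} → state ρ 0 r ≡ just S → Live p m ρ
          go {⟨ _ ! _ ⟩ _} at-r with receiver-⊢ {bs = bs} {env} i (s≢ i) (typed ty r at-r)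
          ... | R , post , r with post r
          ...   | ()
          go {thread T} at-r = settle (heightᵀ T) ρ T ℕ.≤-refl at-r adm ty busy≤ finish
            where
            finish : ∀ ρ′ T′ → NotMu T′ → state ρ′ 0 r ≡ just (thread T′) →
                     (∀ s → s ≢ r → state ρ 0 s ≡ state ρ′ 0 s) →
                     Typed ps (state ρ′ 0) K → busy (action ρ′) m ≤ b → Live p m ρ′
            finish ρ′ T′ ¬μ at-r′ same ty′ busy≤′
              with ⊢-¿ ¬μ (receiver-⊢ {bs = bs} {env} i (s≢ i) (typed ty′ r at-r′))
            ... | _ , _ , refl , i′ , _ , eq , T⊢ =
              advance-comm ρ′ i′ (≡.trans (≡.sym (same s (s≢ i))) at-s) at-r′ eq P⊢ T⊢
                (λ r′ r′≢s r′≢r → bystander-⊢ {bs = bs} {env} i r′≢s r′≢r)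
                (Admissible-branch adm i) ty′ busy≤′
                λ p≢s p≢r ρ″ ty″ busy≤″ → rec i ρ″ (Admissible-branch adm i) ty″ busy≤″
                  (ℕ.≤-trans (bystander-height {bs = bs} {env} i p≢s p≢r) height≤)
        send : ∀ {S} → state ρ₀ 0 s ≡ just S → Live p m ρ₀
        send {⟨ _ ! _ ⟩ _} at-s = receive ρ₀ at-s ty₀ busy≤₀
        send {thread P} at-s = settle (heightᵀ P) ρ₀ P ℕ.≤-refl at-s adm ty₀ busy≤₀ select
          where
          select : ∀ ρ′ P′ → NotMu P′ → state ρ′ 0 s ≡ just (thread P′) →
                   (∀ r → r ≢ s → state ρ₀ 0 r ≡ state ρ′ 0 r) →
                   Typed ps (state ρ′ 0) K → busy (action ρ′) m ≤ b → Live p m ρ′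
          select ρ′ P′ ¬μ at-s′ _ ty busy≤
            with ⊢-⊕ ¬μ (≡.subst (thread P′ ⊢_) (⇂-sender {bs = bs} {env}) (typed ty s at-s′))
          -- Branch `zero` only witnesses that the sender can move; the run may select any other
          -- branch.
          ... | _ , _ , refl = advance-τ ρ′ at-s′ (choice zero refl) adm ty busy≤ λ where
            ρ″ _ (choice _ _) at-s″ _ ty″ busy≤″ → receive ρ″ at-s″ ty″ busy≤″

      module Descend (h : ℕ) (lower : ∀ ρ K → Admissible p ps K → Typed ps (state ρ 0) K →
                              busy (action ρ) m ≤ b → height (K ⇂ p) < h → Live p m ρ) where

        -- The environment of the body contains `clo (μ G) env` itself, so a structural argument
        -- would be circular. Guardedness lowers the height instead, unless the projection is `end`.
        claim-μ : ∀ {n} (G : Global (suc n)) {env} → Claim h (clo (μ G) env)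
        claim-μ G {env} ρ adm ty busy≤ height≤ with μ-↾ G p | adm
        ... | inj₁ (eq , _) | _ =
          claim-end {h} (≡.cong (subᴾ _) eq) ρ adm ty busy≤ height≤
        ... | inj₂ eq | clo (μ _ _ wf) g pt⊆ adms with ≡.subst Guarded eq g
        ...   | μ ¬exposed g′ = lower ρ (clo G (env ▹ clo (μ G) env))
          (clo wf g′ pt⊆ λ { zero → adm ; (suc x) → adms x })
          (record { raceFree = raceFree ty ; contractive = contractive ty ; present = present ty
                  ; typed = λ r at-r → unfold-⊢ G (typed ty r at-r) })
          busy≤ (ℕ.<-≤-trans (unfold-height G eq ¬exposed) height≤)

        -- `clo (var x) env ⇂ r` computes to `env x ⇂ r`, so typing and height carry over as they
        -- are.
        claim-var : ∀ {n} {x : Fin n} {env} → Claim h (env x) → Claim h (clo (var x) env)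
        claim-var {x = x} claim ρ (clo _ _ _ adms) ty busy≤ height≤ = claim ρ (adms x)
          (record { raceFree = raceFree ty ; contractive = contractive ty ; present = present ty
                  ; typed = typed ty })
          busy≤ height≤

        claim-global  : ∀ {n} (G : Global n) {env} → (∀ x → Claim h (env x)) → Claim h (clo G env)
        claim-globalᵇ : ∀ {n k} (bs : Vec (Branch (Global n)) k) {env} → (∀ x → Claim h (env x)) →
                        ∀ i → Claim h (clo (cont (lookup bs i)) env)
        claim-global end      claims = claim-end refl
        claim-global (⊞ s bs) claims = claim-⊞ (claim-globalᵇ bs claims)
        claim-global (var x)  claims = claim-var (claims x)
        claim-global (μ G)    claims = claim-μ G
        claim-globalᵇ ((_ · _ ⟫ G) ∷ bs) claims zero    = claim-global G claims
        claim-globalᵇ ((_ · _ ⟫ G) ∷ bs) claims (suc i) = claim-globalᵇ bs claims i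

        claim : ∀ K → Claim h K
        claim (clo G env) = claim-global G (λ x → claim (env x))

    -- Lexicographic recursion on the two strict bounds: when `b` drops, `h` is reset to what the
    -- new type requires.
    live-bounded : ∀ b h ρ K → Admissible p ps K → Typed ps (state ρ 0) K →
                   busy (action ρ) m < b → height (K ⇂ p) < h → Live p m ρ
    live-bounded (suc b) (suc h) ρ K adm ty (s≤s busy≤) (s≤s height≤) =
      Bounded.Descend.claim b
        (λ ρ K adm ty busy< → live-bounded b (suc (height (K ⇂ p))) ρ K adm ty busy< ℕ.≤-refl)
        h
        (λ ρ K adm ty busy≤ → live-bounded (suc b) h ρ K adm ty (s≤s busy≤))
        K ρ adm ty busy≤ height≤

    live : ∀ ρ K → Admissible p ps K → Typed ps (state ρ 0) K → Live p m ρ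
    live ρ K adm ty = live-bounded _ _ ρ K adm ty ℕ.≤-refl ℕ.≤-refl

  -- From paths to runs

  -- Values of a path beyond its length are junk; with clamped indices the run rests in the final
  -- state.
  clamp : Length → ℕ → ℕ
  clamp (finite n) i = i Nat.⊓ n
  clamp infinite   i = i

  clamp-≤ᴸ : ∀ L i → clamp L i ≤ᴸ L
  clamp-≤ᴸ (finite n) i = ℕ.m⊓n≤n i n
  clamp-≤ᴸ infinite   i = tt

  clamp-≤ : ∀ L {i} → i ≤ᴸ L → clamp L i ≡ i
  clamp-≤ (finite n) i≤n = ℕ.m≤n⇒m⊓n≡m i≤n
  clamp-≤ infinite   _   = refl

  <ᴸ⇒≤ᴸ : ∀ L {i} → i <ᴸ L → i ≤ᴸ L
  <ᴸ⇒≤ᴸ (finite n) i<n = ℕ.<⇒≤ i<n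
  <ᴸ⇒≤ᴸ infinite   _   = tt

  <ᴸ⇒suc≤ᴸ : ∀ L {i} → i <ᴸ L → suc i ≤ᴸ L
  <ᴸ⇒suc≤ᴸ (finite n) i<n = i<n
  <ᴸ⇒suc≤ᴸ infinite   _   = tt

  suc≤ᴸ⇒<ᴸ : ∀ L {i} → suc i ≤ᴸ L → i <ᴸ L
  suc≤ᴸ⇒<ᴸ (finite n) i<n = i<n
  suc≤ᴸ⇒<ᴸ infinite   _   = tt

  clamp-≮ : ∀ L {i} → ¬ i <ᴸ L → clamp L i ≡ clamp L (suc i)
  clamp-≮ (finite n) i≮n =
    ≡.trans (ℕ.m≥n⇒m⊓n≡n n≤i) (≡.sym (ℕ.m≥n⇒m⊓n≡n (ℕ.m≤n⇒m≤1+n n≤i)))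
    where n≤i = ℕ.≮⇒≥ i≮n
  clamp-≮ infinite i≮ = ⊥-elim (i≮ tt)

  -- For `i` beyond the end of a finite path the premises conflict, as the clamped index is then the
  -- length itself.
  clamp-reflects-≤ : ∀ L {i k} → clamp L i ≤ k → k <ᴸ L → i ≤ k
  clamp-reflects-≤ (finite n) {i} c≤k k<n with ℕ.≤-total i n
  ... | inj₁ i≤n = ≡.subst (_≤ _) (ℕ.m≤n⇒m⊓n≡m i≤n) c≤k
  ... | inj₂ n≤i = ⊥-elim (ℕ.<⇒≱ k<n (≡.subst (_≤ _) (ℕ.m≥n⇒m⊓n≡n n≤i) c≤k))
  clamp-reflects-≤ infinite c≤k _ = c≤k

  module PathRun (π : Path) (just-π : Just π) (distinct₀ : Distinct (Path.state π 0)) where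

    open Path π using (length) renaming (state to st; action to ac; step to sp)

    distinctᵢ : ∀ i → i ≤ᴸ length → Distinct (st i)
    distinctᵢ zero    _  = distinct₀
    distinctᵢ (suc i) i< = proj₂ (sound (distinctᵢ i (<ᴸ⇒≤ᴸ length (suc≤ᴸ⇒<ᴸ length i<)))
                                        (sp i (suc≤ᴸ⇒<ᴸ length i<)))

    distinct-clamp : ∀ i → Distinct (st (clamp length i))
    distinct-clamp i = distinctᵢ _ (clamp-≤ᴸ length i)

    stateᴿ : ℕ → Config
    stateᴿ i = ⟦ st (clamp length i) ⟧ᶜ

    actionᴿ : ℕ → Maybe Action
    actionᴿ i with em {i <ᴸ length}
    ... | yes _ = just (ac i)
    ... | no _  = nothing

    stepᴿ : ∀ i → Stepᴹ (stateᴿ i) (actionᴿ i) (stateᴿ (suc i))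
    stepᴿ i with em {i <ᴸ length}
    ... | yes i< = ≡.subst₂ (λ k l → Step ⟦ st k ⟧ᶜ (ac i) ⟦ st l ⟧ᶜ)
      (≡.sym (clamp-≤ length (<ᴸ⇒≤ᴸ length i<))) (≡.sym (clamp-≤ length (<ᴸ⇒suc≤ᴸ length i<)))
      (proj₁ (sound (distinctᵢ i (<ᴸ⇒≤ᴸ length i<)) (sp i i<)))
    ... | no i≮ = λ r → ≡.cong (λ k → ⟦ st k ⟧ᶜ r) (clamp-≮ length i≮)

    actionᴿ-< : ∀ {i} → i <ᴸ length → actionᴿ i ≡ just (ac i)
    actionᴿ-< {i} i< with em {i <ᴸ length}
    ... | yes _ = refl
    ... | no i≮ = ⊥-elim (i≮ i<)

    justᴿ : ∀ i {α d} → Step (stateᴿ i) α d → ∃[ k ] i ≤ k × Meets α (actionᴿ k)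
    justᴿ i {α} s with complete (distinct-clamp i) s
    ... | _ , t , _ with just-π _ (clamp-≤ᴸ length i) t
    -- Non-concurrency is a negation; excluded middle extracts a common location from it.
    ... | k , c≤k , k< , ¬conc with em {Meets α (just (ac k))}
    ...   | yes met = k , clamp-reflects-≤ length c≤k k< ,
                      ≡.subst (Meets α) (≡.sym (actionᴿ-< k<)) met
    ...   | no ¬met = ⊥-elim (¬conc λ (r∈ , r∈′) → ¬met (_ , r∈ , r∈′))

    run : Run
    run = record { state = stateᴿ ; action = actionᴿ ; step = stepᴿ ; isJust = justᴿ }

    Live⇒ : ∀ {p m} → Live p m run →
            SuccessfullyTerminates p π ⊎ ∃[ i ] m ≤ i × i <ᴸ length × Involves (ac i) p
    Live⇒ (inj₁ (i , m≤i , p∈)) with em {i <ᴸ length} | p∈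
    ... | yes i< | p∈′ = inj₂ (i , m≤i , i< , p∈′)
    ... | no _   | ()
    Live⇒ (inj₂ (i , eq)) = inj₁ (_ , clamp-≤ᴸ length i , proc _ eq)

  just-lock-free : (N : NetState) → IsNetwork N → GuardedlyWellTyped N → RaceFree N → 𝓛 Just N
  just-lock-free N net (G , wf , (pt⊆ , typing) , guarded) rf π just-π start p p∈
    -- `live` yields a disjunction for each `m` separately, while the conclusion needs one disjunct
    -- for all `m`; so termination is decided first.
    with em {SuccessfullyTerminates p π}
  ... | yes terminates = inj₁ terminates
  ... | no ¬terminates = inj₂ λ m →
    [ ⊥-elim ∘ ¬terminates , id ]′ (Live⇒ (live p m (locs N) p∈ run K adm ty))
    where
    open IsNetwork net
    N≅ : N ≅ Path.state π 0
    N≅ = sym start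
    open PathRun π just-π (≅-Distinct N≅ distinct)
    K : Closure
    K = clo G λ ()
    ⇂≡↾ : ∀ r → K ⇂ r ≡ G ↾ r
    ⇂≡↾ r = subᴾ-var (λ ()) (G ↾ r)
    initial : ∀ r → ⟦ N ⟧ᶜ r ≡ stateᴿ 0 r
    initial r = ≡.trans (≅-⟦⟧ distinct N≅ r)
      (≡.cong (λ k → ⟦ Path.state π k ⟧ᶜ r) (≡.sym (clamp-≤ (Path.length π) (0≤ᴸ (Path.length π)))))
      where
      0≤ᴸ : ∀ L → 0 ≤ᴸ L
      0≤ᴸ (finite n) = z≤n
      0≤ᴸ infinite   = tt
    adm : Admissible p (locs N) K
    adm = clo wf (guarded p p∈) pt⊆ λ ()
    ty : Typed (locs N) (stateᴿ 0) K
    ty = record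
      { raceFree    = N , distinct , rf , initial
      ; contractive = λ r at-r → case threads (find⇒∈ (≡.trans (initial r) at-r)) of λ where
          (_ , refl , wfᵀ , _) → WFᵀ⇒Contractive wfᵀ
      ; present     = λ r r∈ → let S , eq = ∈⇒find-just r∈ in S , ≡.trans (≡.sym (initial r)) eq
      ; typed       = λ r {S} at-r → ≡.subst (S ⊢_) (≡.sym (⇂≡↾ r))
          (typing r S (proc N (≡.trans (initial r) at-r)))
      }

mainTheorem2 : (em : ExcludedMiddle 0ℓ) (Loc Lab : Set) →
    let open Session Loc Lab (λ p q → em {p ≡ q}) in
    (N : NetState) → IsNetwork N → GuardedlyWellTyped N → RaceFree N → 𝓛 Just N
mainTheorem2 = Development.just-lock-free
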